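{- There is a function $g\colon\mathbb{N}\to\mathbb{R}$ with $g(n)=o(n)$ such that for every colored graph $(G,\chi)$ with $n=|V(G)|$ vertices, $\mathrm{WLD}_2(G,\chi)\le\frac{n}{4}+g(n)$.
   Context: Graphs are finite, simple, undirected with non-empty vertex set; a colored graph $(G,\chi)$ has a vertex coloring $\chi\colon V(G)\to C$; $\mathrm{im}(\chi)$ is its set of colors. For $k\ge1$, $\mathrm{WL}_k(G,\chi)$ denotes the stable coloring of $V(G)^k$ computed by the $k$-dimensional Weisfeiler--Leman algorithm (for $k=1$: color refinement, where a vertex's new color is its old color together with the multiset of its neighbors' old colors; for $k\ge2$: tuples initially colored by the isomorphism type of the induced ordered colored subgraph, and refined by the multiset over $w$ of the tuples of colors of $\bar v[w/1],\dots,\bar v[w/k]$, $\bar v[w/i]$ replacing the $i$-th entry by $w$). For a vertex $v$, $\mathrm{WL}_k(G,\chi)(v)$ means the color of $(v,\dots,v)$. For $u\in V(G)$, $\chi[u]$ gives $u$ a new unique color. A flip function for $(G,\chi)$ is a symmetric map $f\colon\mathrm{im}(\chi)^2\to\{0,1\}$; $\mathrm{flip}_f(G,\chi)=(G',\chi)$ with $V(G')=V(G)$ and, for distinct $v,w$, $vw\in E(G')$ iff ($vw\in E(G)$ xor $f(\chi(v),\chi(w))=1$). A $k$-IRC tree of $(G,\chi)$ is a rooted tree $(T,r)$ with $\gamma$ assigning each node $t$ a colored graph $(G_t,\chi_t)$, $\gamma(r)=(G,\chi)$, every leaf has $|V(G_t)|=1$, and each internal node satisfies at least one of: (D1) one child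 $s$, $G_s=G_t$, $\chi_s(v)=\mathrm{WL}_k(G_t,\chi_t)(v)$; (D2) one child $s$ with $(G_s,\chi_s)=\mathrm{flip}_f(G_t,\chi_t)$ for some flip function $f$; (D3) $G_t$ has components with vertex sets $A_1,\dots,A_\ell$ and $t$ has $\ell$ children $s_i$ with $(G_{s_i},\chi_{s_i})=(G_t[A_i],\chi_t|_{A_i})$; (D4) one child $s$ with $G_s=G_t$, $\chi_s=\chi_t[u]$ for some $u$. An individualization node satisfies (D4) and none of (D1)–(D3); the individualization depth is the maximal number of individualization nodes on a root-to-leaf path; the $k$-WL depth $\mathrm{WLD}_k(G,\chi)$ is the minimum individualization depth over all $k$-IRC trees of $(G,\chi)$. -}

module Defs where

open import Data.Nat using (ℕ; zero; suc; _⊔_) renaming (_≤_ to _≤ℕ_)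
open import Data.Bool using (Bool; true; false; if_then_else_; _xor_)
open import Data.Fin using (Fin; _≟_)
open import Data.Product using (Σ; ∃; ∃-syntax; _×_; _,_; proj₁; proj₂)
open import Data.Empty using (⊥)
open import Function.Bundles using (_↔_; Inverse)
open import Relation.Nullary using (¬_; yes; no)
open import Relation.Binary.PropositionalEquality using (_≡_; _≢_; refl; sym; cong)
open import Data.Integer using (+_)
open import Data.Rational using (ℚ; _/_; _≤_; _<_; _+_; _*_; ∣_∣; 0ℚ)

record ColGraph : Set where
  field
    n        : ℕ
    nonempty : 1 ≤ℕ n
    adj      : Fin n → Fin n → Bool
    adj-sym  : ∀ v w → adj v w ≡ adj w v
    adj-irr  : ∀ v → adj v v ≡ false
    col      : Fin n → ℕ

open ColGraph public

recolor : (G : ColGraph) → (Fin (n G) → ℕ) → ColGraph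
recolor G χ = record
  { n = n G ; nonempty = nonempty G ; adj = adj G
  ; adj-sym = adj-sym G ; adj-irr = adj-irr G ; col = χ }

Pair : ColGraph → Set
Pair G = Fin (n G) × Fin (n G)

_⇔_ : Set → Set → Set
A ⇔ B = (A → B) × (B → A)

-- same isomorphism type of the induced ordered colored subgraph
atp : (G : ColGraph) → Pair G → Pair G → Set
atp G (v₁ , v₂) (u₁ , u₂) =
  (col G v₁ ≡ col G u₁) × (col G v₂ ≡ col G u₂) ×
  ((v₁ ≡ v₂) ⇔ (u₁ ≡ u₂)) × (adj G v₁ v₂ ≡ adj G u₁ u₂)

-- equality of colors after i refinement rounds.  Equality of the
-- multisets { (c(v[w/1]), c(v[w/2])) : w } is written out as the
-- existence of a bijection matching the multiset elements.
wl2 : (G : ColGraph) → ℕ → Pair G → Pair G → Set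
wl2 G zero a b = atp G a b
wl2 G (suc i) (a₁ , a₂) (b₁ , b₂) =
  wl2 G i (a₁ , a₂) (b₁ , b₂) ×
  Σ (Fin (n G) ↔ Fin (n G)) λ π → ∀ w →
    wl2 G i (w , a₂) (Inverse.to π w , b₂) ×
    wl2 G i (a₁ , w) (b₁ , Inverse.to π w)

-- equality in the stable coloring WL₂(G,χ) (the intersection of all rounds,
-- which equals the coloring at which the refinement stabilizes)
WL2≈ : (G : ColGraph) → Pair G → Pair G → Set
WL2≈ G a b = ∀ i → wl2 G i a b

IsWL2Coloring : (G : ColGraph) → (Fin (n G) → ℕ) → Set
IsWL2Coloring G χ' = ∀ v w → (χ' v ≡ χ' w) ⇔ WL2≈ G (v , v) (w , w)

flipAdj : (G : ColGraph) → (ℕ → ℕ → Bool) → Fin (n G) → Fin (n G) → Bool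
flipAdj G f v w with v ≟ w
... | yes _ = false
... | no  _ = adj G v w xor f (col G v) (col G w)

flipAdj-sym : (G : ColGraph) (f : ℕ → ℕ → Bool) → (∀ a b → f a b ≡ f b a) →
  ∀ v w → flipAdj G f v w ≡ flipAdj G f w v
flipAdj-sym G f fs v w with v ≟ w | w ≟ v
... | yes _ | yes _ = refl
... | yes p | no ¬q = Data.Empty.⊥-elim (¬q (sym p))
  where import Data.Empty
... | no ¬p | yes q = Data.Empty.⊥-elim (¬p (sym q))
  where import Data.Empty
... | no _ | no _ rewrite adj-sym G v w | fs (col G v) (col G w) = refl

flipAdj-irr : (G : ColGraph) (f : ℕ → ℕ → Bool) → ∀ v → flipAdj G f v v ≡ false
flipAdj-irr G f v with v ≟ v
... | yes _ = refl
... | no ¬p = Data.Empty.⊥-elim (¬p refl)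
  where import Data.Empty

flipG : (G : ColGraph) (f : ℕ → ℕ → Bool) → (∀ a b → f a b ≡ f b a) → ColGraph
flipG G f fs = record
  { n = n G ; nonempty = nonempty G ; adj = flipAdj G f
  ; adj-sym = flipAdj-sym G f fs ; adj-irr = flipAdj-irr G f ; col = col G }

indiv : (G : ColGraph) → Fin (n G) → ℕ → Fin (n G) → ℕ
indiv G u c v with v ≟ u
... | yes _ = c
... | no  _ = col G v

data Reach (G : ColGraph) (v : Fin (n G)) : Fin (n G) → Set where
  here : Reach G v v
  step : ∀ {w u} → Reach G v w → adj G w u ≡ true → Reach G v u

-- H (with embedding ι) is (an isomorphic copy of) the colored induced
-- subgraph G[A] on a connected component A of G.
record IsComponent (G H : ColGraph) (ι : Fin (n H) → Fin (n G)) : Set where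
  field
    inj       : ∀ x y → ι x ≡ ι y → x ≡ y
    adj-pres  : ∀ x y → adj H x y ≡ adj G (ι x) (ι y)
    col-pres  : ∀ x → col H x ≡ col G (ι x)
    connected : ∀ x y → Reach G (ι x) (ι y)
    closed    : ∀ x w → Reach G (ι x) w → ∃[ y ] ι y ≡ w

data IRC2 : ColGraph → Set where
  leaf : ∀ {G} → n G ≡ 1 → IRC2 G
  d1   : ∀ {G} (χ' : Fin (n G) → ℕ) → IsWL2Coloring G χ' →
         IRC2 (recolor G χ') → IRC2 G
  d2   : ∀ {G} (f : ℕ → ℕ → Bool) (fs : ∀ a b → f a b ≡ f b a) →
         IRC2 (flipG G f fs) → IRC2 G
  d3   : ∀ {G} (ℓ : ℕ) (H : Fin ℓ → ColGraph)
         (ι : (i : Fin ℓ) → Fin (n (H i)) → Fin (n G)) →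
         (∀ i → IsComponent G (H i) (ι i)) →
         (∀ v → ∃[ i ] ∃[ x ] ι i x ≡ v) →
         (∀ i j x y → ι i x ≡ ι j y → i ≡ j) →
         ((i : Fin ℓ) → IRC2 (H i)) → IRC2 G
  d4   : ∀ {G} (u : Fin (n G)) (c : ℕ) → (∀ v → col G v ≢ c) →
         IRC2 (recolor G (indiv G u c)) → IRC2 G

maxFin : (ℓ : ℕ) → (Fin ℓ → ℕ) → ℕ
maxFin zero    h = 0
maxFin (suc ℓ) h = h Fin.zero ⊔ maxFin ℓ (λ i → h (Fin.suc i))
  where import Data.Fin as Fin

indDepth : ∀ {G} → IRC2 G → ℕ
indDepth (leaf _) = 0
indDepth (d1 _ _ t) = indDepth t
indDepth (d2 _ _ t) = indDepth t
indDepth (d3 ℓ _ _ _ _ _ ts) = maxFin ℓ (λ i → indDepth (ts i))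
indDepth (d4 _ _ _ t) = suc (indDepth t)

ℕ→ℚ : ℕ → ℚ
ℕ→ℚ m = (+ m) / 1

IsLittleO-n : (ℕ → ℚ) → Set
IsLittleO-n g = ∀ (ε : ℚ) → 0ℚ < ε →
  ∃[ N ] ∀ m → N ≤ℕ m → ∣ g m ∣ ≤ ε * ℕ→ℚ m

WLD2≤ : ColGraph → ℚ → Set
WLD2≤ G b = ∃[ t ] ℕ→ℚ (indDepth {G} t) ≤ b

{-# OPTIONS --safe #-}

-- Fix d. Individualize a vertex and refine whenever this creates at least four new colour classes (at most n/4 times)
-- or splits a class into two parts of size at least d (at most n/d times). When neither is possible, flip every dense pair
-- of classes. Every vertex then has at most d neighbours in each class, and every class is adjacent to at most two others,
-- so the classes form paths and cycles; moreover vertices of one class and one component have distance at most 6, so classes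
-- have bounded size inside a component. Hence balls grow linearly, and ball carving finds at most n/d vertices whose
-- individualization leaves components of size bounded in terms of d. Finally let d grow slowly with n.
module Submission where

open import Defs
open import Data.Bool using (Bool; true; false; if_then_else_; _xor_; _∧_; _∨_; not)
open import Data.Empty using (⊥; ⊥-elim)
open import Data.Fin using (Fin; zero; suc; toℕ; fromℕ<; punchIn; combine; remQuot)
import Data.Fin as Fin
open import Data.Nat using (ℕ; zero; suc; z≤n; s≤s)
import Data.Nat as ℕ
import Data.Nat.Properties as ℕ
open import Data.Nat.Solver using (module +-*-Solver)
open import Data.Product using (Σ; ∃; ∃-syntax; _×_; _,_; proj₁; proj₂)
open import Data.Sum using (_⊎_; inj₁; inj₂)
open import Relation.Nullary using (¬_; Dec; yes; no; contradiction)
open import Relation.Binary.PropositionalEquality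

-- Refinements and flips are free; only individualizations count, so each must be paid for by a
-- potential. A vertex with neighbours in three foreign colours, or the first four vertices of a
-- shortest path, already supply four classes that can be deleted while every old class keeps a
-- member. Failing to gain four classes therefore leaves at most two foreign colours around a
-- vertex. The obstacle: this structure is wanted in the flipped graph, while the potentials refer
-- to colourings refined in the original one. No refinement is run between the flip and the
-- structural analysis. Instead the qualitative half of equitability, `Spread`, is carried over to
-- the flipped graph, both for the current colouring and for each colouring obtained by
-- individualizing one more vertex. Cutting off the carved vertices uses a second flip: once
-- individualized and refined, such a vertex is adjacent to all or none of each class, so flipping
-- deletes all its edges. The error is 3n/d: n/d each for the balanced splits, the carved vertices,
-- and the final pieces, whose size depends on d alone.

module _ where

  open import Data.Bool.Properties using (∧-identityʳ; ∧-zeroʳ; ∧-comm) renaming (_≟_ to _≟ᵇ_)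
  open import Data.Fin.Permutation as Perm using (insert; remove; punchIn-permute; insert-punchIn)
  open import Data.Fin.Properties using (any?; all?; toℕ-injective; toℕ<n; fromℕ<-toℕ; remQuot-combine; ¬∀⟶∃¬) renaming (suc-injective to Fin-suc-injective)
  open import Data.List using (List; []; _∷_; length; tabulate)
  open import Data.List.Membership.DecPropositional using () renaming (_∈?_ to mem?)
  open import Data.List.Membership.Propositional using (_∈_)
  open import Data.List.Membership.Propositional.Properties using (∈-tabulate⁺)
  open import Data.List.Properties using (length-tabulate)
  open import Data.List.Relation.Unary.All as All using (All; []; _∷_)
  open import Data.List.Relation.Unary.AllPairs using (AllPairs; []; _∷_)
  open import Data.List.Relation.Unary.Any using (here; there)
  open import Data.Nat using (_+_; _*_; _∸_; _^_; _≤_; _<_; _≤′_; ≤′-refl; ≤′-step; _≟_; _≤?_; _<?_; >-nonZero)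
  open import Data.Nat.Induction using (<-wellFounded; Acc; acc)
  open import Data.Nat.Properties hiding (_≟_; _≤?_; _<?_)
  open import Function using (_∘_)
  open import Function.Bundles using (_↔_; Inverse)
  open import Relation.Nullary.Decidable using (does; dec-true; dec-false; map′; _×-dec_; _→-dec_; ¬?)
  open import Algebra.Properties.Semiring.Sum +-*-semiring using (sum; sum-cong-≗; ∑-distrib-+; ∑-comm; sum-permute; *-distribʳ-sum)

  -- Finite counting

  ∧-intro : ∀ {a b} → a ≡ true → b ≡ true → a ∧ b ≡ true
  ∧-intro refl refl = refl

  ∧-elimˡ : ∀ {a b} → a ∧ b ≡ true → a ≡ true
  ∧-elimˡ {true} _ = refl

  ∧-elimʳ : ∀ {a b} → a ∧ b ≡ true → b ≡ true
  ∧-elimʳ {true} e = e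

  ∨-introˡ : ∀ {a b} → a ≡ true → a ∨ b ≡ true
  ∨-introˡ refl = refl

  ∨-introʳ : ∀ {a b} → b ≡ true → a ∨ b ≡ true
  ∨-introʳ {true}  _ = refl
  ∨-introʳ {false} e = e

  ∨-elim : ∀ {a b} → a ∨ b ≡ true → a ≡ true ⊎ b ≡ true
  ∨-elim {true}  _ = inj₁ refl
  ∨-elim {false} e = inj₂ e

  not-intro : ∀ {a} → a ≡ false → not a ≡ true
  not-intro refl = refl

  not-elim : ∀ {a} → not a ≡ true → a ≡ false
  not-elim {false} _ = refl

  true≢false : ∀ {a} → a ≡ true → a ≡ false → ⊥
  true≢false refl ()

  ¬true⇒false : ∀ {a} → ¬ (a ≡ true) → a ≡ false
  ¬true⇒false {true}  h = contradiction refl h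
  ¬true⇒false {false} _ = refl

  ¬imp⇒ : ∀ {a b} → ¬ (a ≡ true → b ≡ true) → a ≡ true × b ≡ false
  ¬imp⇒ {_}     {true}  h = ⊥-elim (h (λ _ → refl))
  ¬imp⇒ {false} {false} h = ⊥-elim (h (λ e → e))
  ¬imp⇒ {true}  {false} h = refl , refl

  bool-ext : ∀ {a b} → (a ≡ true → b ≡ true) → (b ≡ true → a ≡ true) → a ≡ b
  bool-ext {true}  {b}     f g = sym (f refl)
  bool-ext {false} {true}  f g = g refl
  bool-ext {false} {false} f g = refl

  does-elim : ∀ {P : Set} (P? : Dec P) → does P? ≡ true → P
  does-elim (yes p) _ = p

  infix 4 _≐_

  abstract
    _≐_ : ∀ {m} → Fin m → Fin m → Bool
    x ≐ y = does (x Fin.≟ y)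

    ≐-intro : ∀ {m} {x y : Fin m} → x ≡ y → (x ≐ y) ≡ true
    ≐-intro {x = x} {y} = dec-true (x Fin.≟ y)

    ≐-elim : ∀ {m} {x y : Fin m} → (x ≐ y) ≡ true → x ≡ y
    ≐-elim {x = x} {y} = does-elim (x Fin.≟ y)

    some : ∀ {m} → (Fin m → Bool) → Bool
    some p = does (any? (λ x → p x ≟ᵇ true))

    some-intro : ∀ {m} (p : Fin m → Bool) x → p x ≡ true → some p ≡ true
    some-intro p x px = dec-true (any? (λ x → p x ≟ᵇ true)) (x , px)

    some-elim : ∀ {m} (p : Fin m → Bool) → some p ≡ true → ∃[ x ] p x ≡ true
    some-elim p = does-elim (any? (λ x → p x ≟ᵇ true))

  ≐-refl : ∀ {m} (x : Fin m) → (x ≐ x) ≡ true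
  ≐-refl x = ≐-intro refl

  sum-mono-≤ : ∀ {m} {f g : Fin m → ℕ} → (∀ x → f x ≤ g x) → sum f ≤ sum g
  sum-mono-≤ {zero}  h = z≤n
  sum-mono-≤ {suc m} h = +-mono-≤ (h zero) (sum-mono-≤ (h ∘ suc))

  sum-mono-drop : ∀ {m} {f g : Fin m → ℕ} {k} x₀ → (∀ x → f x ≤ g x) → f x₀ + k ≤ g x₀ → sum f + k ≤ sum g
  sum-mono-drop {suc m} {f} {g} {k} zero h hk = begin
    f zero + sum (f ∘ suc) + k   ≡⟨ +-assoc (f zero) _ k ⟩
    f zero + (sum (f ∘ suc) + k) ≡⟨ cong (f zero +_) (+-comm _ k) ⟩
    f zero + (k + sum (f ∘ suc)) ≡⟨ +-assoc (f zero) k _ ⟨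
    f zero + k + sum (f ∘ suc)   ≤⟨ +-mono-≤ hk (sum-mono-≤ (h ∘ suc)) ⟩
    g zero + sum (g ∘ suc)       ∎
    where open ≤-Reasoning
  sum-mono-drop {suc m} {f} {g} {k} (suc x₀) h hk = begin
    f zero + sum (f ∘ suc) + k   ≡⟨ +-assoc (f zero) _ k ⟩
    f zero + (sum (f ∘ suc) + k) ≤⟨ +-mono-≤ (h zero) (sum-mono-drop x₀ (h ∘ suc) hk) ⟩
    g zero + sum (g ∘ suc)       ∎
    where open ≤-Reasoning

  term≤sum : ∀ {m} (f : Fin m → ℕ) x → f x ≤ sum f
  term≤sum f zero    = m≤m+n _ _
  term≤sum f (suc x) = ≤-trans (term≤sum (f ∘ suc) x) (m≤n+m _ (f zero))

  ∸-superadditive : ∀ k a b → (a ∸ k) + (b ∸ k) ≤ (a + b) ∸ k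
  ∸-superadditive k a b with ≤-total k a
  ... | inj₁ k≤a = ≤-trans (+-monoʳ-≤ (a ∸ k) (m∸n≤m b k)) (≤-reflexive (sym (+-∸-comm b k≤a)))
  ... | inj₂ a≤k rewrite m≤n⇒m∸n≡0 a≤k = ∸-monoˡ-≤ k (m≤n+m b a)

  -- With both summands at least `k`, the left side truncates twice and the right side once. The
  -- surplus `k` is the gain in `excess-drop`.
  ∸-superadditive-strict : ∀ {k a b} → k ≤ a → k ≤ b → (a ∸ k) + (b ∸ k) + k ≤ (a + b) ∸ k
  ∸-superadditive-strict {k} {a} {b} k≤a k≤b = ≤-reflexive (begin
    (a ∸ k) + (b ∸ k) + k   ≡⟨ +-assoc (a ∸ k) (b ∸ k) k ⟩
    (a ∸ k) + ((b ∸ k) + k) ≡⟨ cong ((a ∸ k) +_) (m∸n+n≡m k≤b) ⟩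
    (a ∸ k) + b             ≡⟨ +-∸-comm b k≤a ⟨
    (a + b) ∸ k             ∎)
    where open ≡-Reasoning

  sum-∸ : ∀ {m} (f : Fin m → ℕ) k → sum (λ x → f x ∸ k) ≤ sum f ∸ k
  sum-∸ {zero}  f k = z≤n
  sum-∸ {suc m} f k = ≤-trans (+-monoʳ-≤ (f zero ∸ k) (sum-∸ (f ∘ suc) k)) (∸-superadditive k (f zero) _)

  𝟙 : Bool → ℕ
  𝟙 b = if b then 1 else 0

  𝟙≤1 : ∀ b → 𝟙 b ≤ 1
  𝟙≤1 true  = ≤-refl
  𝟙≤1 false = z≤n

  𝟙-mono : ∀ {a b} → (a ≡ true → b ≡ true) → 𝟙 a ≤ 𝟙 b
  𝟙-mono {true}  h rewrite h refl = ≤-refl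
  𝟙-mono {false} h = z≤n

  𝟙-true : ∀ {a} → a ≡ true → 𝟙 a ≡ 1
  𝟙-true refl = refl

  count : ∀ {m} → (Fin m → Bool) → ℕ
  count p = sum (λ x → 𝟙 (p x))

  count-cong : ∀ {m} {p q : Fin m → Bool} → p ≗ q → count p ≡ count q
  count-cong h = sum-cong-≗ (λ x → cong 𝟙 (h x))

  count-mono : ∀ {m} {p q : Fin m → Bool} → (∀ x → p x ≡ true → q x ≡ true) → count p ≤ count q
  count-mono h = sum-mono-≤ (λ x → 𝟙-mono (h x))

  count≤size : ∀ {m} (p : Fin m → Bool) → count p ≤ m
  count≤size {zero}  p = z≤n
  count≤size {suc m} p = +-mono-≤ (𝟙≤1 (p zero)) (count≤size (p ∘ suc))

  count-true : ∀ m → count {m} (λ _ → true) ≡ m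
  count-true zero    = refl
  count-true (suc m) = cong suc (count-true m)

  count-positive : ∀ {m} (p : Fin m → Bool) x → p x ≡ true → 1 ≤ count p
  count-positive p x px = ≤-trans (≤-reflexive (sym (𝟙-true px))) (term≤sum (λ x → 𝟙 (p x)) x)

  count-zero : ∀ {m} (p : Fin m → Bool) → (∀ x → p x ≡ false) → count p ≡ 0
  count-zero {zero}  p h = refl
  count-zero {suc m} p h rewrite h zero = count-zero (p ∘ suc) (h ∘ suc)

  count-∃ : ∀ {m} (p : Fin m → Bool) → 1 ≤ count p → ∃[ x ] p x ≡ true
  count-∃ {suc m} p h with p zero in eq
  ... | true  = zero , eq
  ... | false with count-∃ (p ∘ suc) h
  ...   | x , px = suc x , px

  count-unique : ∀ {m} (p : Fin m → Bool) → (∀ x y → p x ≡ true → p y ≡ true → x ≡ y) → count p ≤ 1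
  count-unique {zero}  p h = z≤n
  count-unique {suc m} p h with p zero in eq
  ... | true  = ≤-reflexive (cong suc (count-zero (p ∘ suc) (λ x → ¬true⇒false (λ px → 0≢suc (h zero (suc x) eq px)))))
    where
    0≢suc : ∀ {x : Fin m} → Fin.zero ≢ Fin.suc x
    0≢suc ()
  ... | false = count-unique (p ∘ suc) (λ x y px py → Fin-suc-injective (h (suc x) (suc y) px py))

  count-≐ : ∀ {m} (x : Fin m) → count (x ≐_) ≡ 1
  count-≐ x = ≤-antisym (count-unique (x ≐_) (λ y z p q → trans (sym (≐-elim p)) (≐-elim q)))
                        (count-positive (x ≐_) x (≐-refl x))

  count-split : ∀ {m} (p q : Fin m → Bool) → count p ≡ count (λ x → p x ∧ q x) + count (λ x → p x ∧ not (q x))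
  count-split p q = trans (sum-cong-≗ (λ x → split (p x) (q x))) (∑-distrib-+ _ (λ x → 𝟙 (p x ∧ not (q x))))
    where
    split : ∀ a b → 𝟙 a ≡ 𝟙 (a ∧ b) + 𝟙 (a ∧ not b)
    split true  true  = refl
    split true  false = refl
    split false _     = refl

  count-∨ : ∀ {m} (p q : Fin m → Bool) → count (λ x → p x ∨ q x) ≤ count p + count q
  count-∨ p q = ≤-trans (sum-mono-≤ (λ x → union (p x) (q x))) (≤-reflexive (∑-distrib-+ _ (λ x → 𝟙 (q x))))
    where
    union : ∀ a b → 𝟙 (a ∨ b) ≤ 𝟙 a + 𝟙 b
    union true  b = m≤m+n 1 _
    union false b = ≤-refl

  count-disjoint : ∀ {m} (p q r : Fin m → Bool) → (∀ x → p x ≡ true → r x ≡ true) → (∀ x → q x ≡ true → r x ≡ true) →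
    (∀ x → p x ≡ true → q x ≡ true → ⊥) → count p + count q ≤ count r
  count-disjoint p q r p⊆r q⊆r p∩q = ≤-trans (≤-reflexive (sym (∑-distrib-+ _ (λ x → 𝟙 (q x)))))
    (sum-mono-≤ (λ x → disjoint (p⊆r x) (q⊆r x) (p∩q x)))
    where
    disjoint : ∀ {a b c} → (a ≡ true → c ≡ true) → (b ≡ true → c ≡ true) → (a ≡ true → b ≡ true → ⊥) → 𝟙 a + 𝟙 b ≤ 𝟙 c
    disjoint {true}  {true}  f g h = contradiction refl (h refl)
    disjoint {true}  {false} f g h rewrite f refl = ≤-refl
    disjoint {false} {b}     f g h = 𝟙-mono g

  count-strict : ∀ {m} (p q : Fin m → Bool) x → (∀ x → p x ≡ true → q x ≡ true) → p x ≡ false → q x ≡ true → count p < count q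
  count-strict p q x p⊆q px qx = ≤-trans (≤-reflexive (+-comm 1 _))
    (sum-mono-drop x (λ y → 𝟙-mono (p⊆q y)) (≤-reflexive (cong₂ (λ a b → 𝟙 a + b) px (sym (𝟙-true qx)))))

  count<⇒∃ : ∀ {m} (p q : Fin m → Bool) → count p < count q → ∃[ x ] q x ≡ true × p x ≡ false
  count<⇒∃ p q p<q with any? (λ x → q x ∧ not (p x) ≟ᵇ true)
  ... | yes (x , e) = x , ∧-elimˡ e , not-elim (∧-elimʳ {q x} e)
  ... | no none     = contradiction (count-mono (λ x qx → q⊆p x qx)) (<⇒≱ p<q)
    where
    q⊆p : ∀ x → q x ≡ true → p x ≡ true
    q⊆p x qx with p x in eq
    ... | true  = refl
    ... | false = ⊥-elim (none (x , ∧-intro qx (not-intro eq)))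

  count-fibres : ∀ {m k} (κ : Fin m → Fin k) (p : Fin m → Bool) → sum (λ c → count (λ x → (κ x ≐ c) ∧ p x)) ≡ count p
  count-fibres κ p = trans (∑-comm (λ c x → 𝟙 ((κ x ≐ c) ∧ p x))) (sum-cong-≗ fibre)
    where
    fibre : ∀ x → count (λ c → (κ x ≐ c) ∧ p x) ≡ 𝟙 (p x)
    fibre x with p x
    ... | true  = trans (count-cong (λ c → ∧-identityʳ (κ x ≐ c))) (count-≐ (κ x))
    ... | false = count-zero _ (λ c → ∧-zeroʳ (κ x ≐ c))

  count-injection : ∀ {m k} (p : Fin m → Bool) (q : Fin k → Bool) (f : Fin m → Fin k) →
    (∀ x → p x ≡ true → q (f x) ≡ true) → (∀ x y → p x ≡ true → p y ≡ true → f x ≡ f y → x ≡ y) → count p ≤ count q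
  count-injection {m} {k} p q f p⊆q inj = begin
    count p                                      ≡⟨ count-fibres f p ⟨
    sum (λ y → count (λ x → (f x ≐ y) ∧ p x))    ≤⟨ sum-mono-≤ preimage ⟩
    count q                                      ∎
    where
    open ≤-Reasoning
    preimage : ∀ y → count (λ x → (f x ≐ y) ∧ p x) ≤ 𝟙 (q y)
    preimage y with q y in eq
    ... | true  = count-unique _ (λ x x' h h' → inj x x' (∧-elimʳ {f x ≐ y} h) (∧-elimʳ {f x' ≐ y} h')
                    (trans (≐-elim (∧-elimˡ h)) (sym (≐-elim (∧-elimˡ h')))))
    ... | false = ≤-reflexive (count-zero _ (λ x → ¬true⇒false (λ h →
                    true≢false (trans (sym (cong q (≐-elim (∧-elimˡ h)))) (p⊆q x (∧-elimʳ {f x ≐ y} h))) eq)))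

  -- The list may repeat colours, which only weakens the bound, so callers can name colours without
  -- checking that they are distinct.
  count-cover : ∀ {m k} (κ : Fin m → Fin k) (p : Fin m → Bool) (t : ℕ) (cs : List (Fin k)) →
    (∀ x → p x ≡ true → κ x ∈ cs) → (∀ c → count (λ x → p x ∧ (κ x ≐ c)) ≤ t) → count p ≤ length cs * t
  count-cover κ p t [] cov bound = ≤-reflexive (count-zero p (λ x → ¬true⇒false (λ px → empty (cov x px))))
    where
    empty : ∀ {x} → ¬ (κ x ∈ [])
    empty ()
  count-cover κ p t (c ∷ cs) cov bound = begin
    count p                                                               ≡⟨ count-split p (λ x → κ x ≐ c) ⟩
    count (λ x → p x ∧ (κ x ≐ c)) + count (λ x → p x ∧ not (κ x ≐ c))     ≤⟨ +-mono-≤ (bound c) rest ⟩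
    t + length cs * t                                                     ∎
    where
    open ≤-Reasoning
    q = λ x → p x ∧ not (κ x ≐ c)
    tail-cover : ∀ x → q x ≡ true → κ x ∈ cs
    tail-cover x qx with cov x (∧-elimˡ qx)
    ... | here κx≡c  = ⊥-elim (true≢false (≐-intro κx≡c) (not-elim (∧-elimʳ {p x} qx)))
    ... | there κx∈cs = κx∈cs
    rest : count q ≤ length cs * t
    rest = count-cover κ q t cs tail-cover
      (λ c' → ≤-trans (count-mono (λ x e → ∧-intro (∧-elimˡ {p x} (∧-elimˡ {q x} e)) (∧-elimʳ {q x} e))) (bound c'))

  -- An upward search that ends because `μ` cannot fall forever. It finds the round at which
  -- refinement stabilizes and the radius at which a ball stops growing.
  descent : (P : ℕ → Set) → (∀ r → Dec (P r)) → (μ : ℕ → ℕ) → (∀ r → ¬ P r → μ (suc r) < μ r) → ∃ P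
  descent P P? μ drop = go 0 (<-wellFounded (μ 0))
    where
    go : ∀ r → Acc _<_ (μ r) → ∃ P
    go r (acc rec) with P? r
    ... | yes pr = r , pr
    ... | no ¬pr = go (suc r) (rec (drop r ¬pr))

  enumerate : ∀ {m} (p : Fin m → Bool) → Σ (Fin (count p) → Fin m) λ e →
    (∀ i j → e i ≡ e j → i ≡ j) × (∀ i → p (e i) ≡ true) × (∀ x → p x ≡ true → ∃[ i ] e i ≡ x)
  enumerate {zero}  p = (λ ()) , (λ ()) , (λ ()) , λ ()
  enumerate {suc m} p with p zero in eq | enumerate (p ∘ suc)
  ... | true | e , inj , mem , cov = e' , inj' , mem' , cov'
    where
    e' : Fin (suc (count (p ∘ suc))) → Fin (suc m)
    e' zero    = zero
    e' (suc i) = suc (e i)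
    inj' : ∀ i j → e' i ≡ e' j → i ≡ j
    inj' zero    zero    _  = refl
    inj' (suc i) (suc j) eq = cong suc (inj i j (Fin-suc-injective eq))
    mem' : ∀ i → p (e' i) ≡ true
    mem' zero    = eq
    mem' (suc i) = mem i
    cov' : ∀ x → p x ≡ true → ∃[ i ] e' i ≡ x
    cov' zero    _  = zero , refl
    cov' (suc x) px with cov x px
    ... | i , ei = suc i , cong suc ei
  ... | false | e , inj , mem , cov = suc ∘ e , (λ i j eq → inj i j (Fin-suc-injective eq)) , mem , cov'
    where
    cov' : ∀ x → p x ≡ true → ∃[ i ] suc (e i) ≡ x
    cov' zero    px = ⊥-elim (true≢false px eq)
    cov' (suc x) px with cov x px
    ... | i , ei = i , cong suc ei

  first : ∀ {m} → (Fin (suc m) → Bool) → Fin (suc m)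
  first {zero}  p = zero
  first {suc m} p = if p zero then zero else suc (first (p ∘ suc))

  first-holds : ∀ {m} (p : Fin (suc m) → Bool) x → p x ≡ true → p (first p) ≡ true
  first-holds {zero}  p zero px = px
  first-holds {suc m} p x    px with p zero in eq | x
  ... | true  | _     = eq
  ... | false | zero  = ⊥-elim (true≢false px eq)
  ... | false | suc x = first-holds (p ∘ suc) x px

  first-cong : ∀ {m} {p q : Fin (suc m) → Bool} → p ≗ q → first p ≡ first q
  first-cong {zero}  h = refl
  first-cong {suc m} h rewrite h zero | first-cong (h ∘ suc) = refl

  -- Each class is named by its least member. Equivalent elements have pointwise equal class
  -- predicates, hence the same least member.
  classify : ∀ {m} (_~_ : Fin m → Fin m → Set) → (∀ x y → Dec (x ~ y)) → (∀ x → x ~ x) →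
    (∀ {x y} → x ~ y → y ~ x) → (∀ {x y z} → x ~ y → y ~ z → x ~ z) →
    Σ (Fin m → Fin m) λ κ → ∀ x y → (κ x ≡ κ y) ⇔ (x ~ y)
  classify {zero}  _~_ _~?_ ~refl ~sym ~trans = (λ ()) , λ ()
  classify {suc m} _~_ _~?_ ~refl ~sym ~trans = κ , λ x y → to x y , from x y
    where
    class : Fin (suc m) → Fin (suc m) → Bool
    class x y = does (y ~? x)
    κ : Fin (suc m) → Fin (suc m)
    κ x = first (class x)
    κ~ : ∀ x → κ x ~ x
    κ~ x = does-elim (κ x ~? x) (first-holds (class x) x (dec-true (x ~? x) (~refl x)))
    to : ∀ x y → κ x ≡ κ y → x ~ y
    to x y e = ~trans (~sym (κ~ x)) (subst (_~ y) (sym e) (κ~ y))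
    from : ∀ x y → x ~ y → κ x ≡ κ y
    from x y x~y = first-cong (λ z → bool-ext
      (λ e → dec-true (z ~? y) (~trans (does-elim (z ~? x) e) x~y)) (λ e → dec-true (z ~? x) (~trans (does-elim (z ~? y) e) (~sym x~y))))

  -- Stable 2-WL colourings

  Matching : ∀ {m} → (Fin m → Fin m → Set) → Set
  Matching {m} Q = Σ (Fin m ↔ Fin m) λ π → ∀ w → Q w (Inverse.to π w)

  -- A bijection amounts to an image for `zero` together with a bijection of the remaining points,
  -- renumbered by `punchIn`; the search recurses on this. It makes every refinement round
  -- decidable.
  matching? : ∀ {m} {Q : Fin m → Fin m → Set} → (∀ x y → Dec (Q x y)) → Dec (Matching Q)
  matching? {zero}      Q? = yes (Perm.id , λ ())
  matching? {suc m} {Q} Q? =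
    map′ extend restrict (any? (λ j → Q? zero j ×-dec matching? (λ x y → Q? (suc x) (punchIn j y))))
    where
    Rest : Fin (suc m) → Set
    Rest j = Q zero j × Matching (λ x y → Q (suc x) (punchIn j y))
    extend : ∃ Rest → Matching Q
    extend (j , q , π , h) = insert zero j π , λ where
      zero    → q
      (suc w) → subst (Q (suc w)) (sym (insert-punchIn zero j π w)) (h w)
    restrict : Matching Q → ∃ Rest
    restrict (π , h) = Inverse.to π zero , h zero , remove zero π ,
      λ w → subst (Q (suc w)) (punchIn-permute π zero w) (h (suc w))

  module _ (G : ColGraph) where

    private
      k = n G

    atp? : ∀ a b → Dec (atp G a b)
    atp? (v₁ , v₂) (u₁ , u₂) =
      (col G v₁ ≟ col G u₁) ×-dec (col G v₂ ≟ col G u₂) ×-dec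
      (((v₁ Fin.≟ v₂) →-dec (u₁ Fin.≟ u₂)) ×-dec ((u₁ Fin.≟ u₂) →-dec (v₁ Fin.≟ v₂))) ×-dec
      (adj G v₁ v₂ ≟ᵇ adj G u₁ u₂)

    wl2? : ∀ i a b → Dec (wl2 G i a b)
    wl2? zero    a         b         = atp? a b
    wl2? (suc i) (a₁ , a₂) (b₁ , b₂) = wl2? i (a₁ , a₂) (b₁ , b₂) ×-dec
      matching? (λ w z → wl2? i (w , a₂) (z , b₂) ×-dec wl2? i (a₁ , w) (b₁ , z))

    wl2-refl : ∀ i a → wl2 G i a a
    wl2-refl zero    a         = refl , refl , ((λ e → e) , λ e → e) , refl
    wl2-refl (suc i) (a₁ , a₂) = wl2-refl i _ , Perm.id , λ w → wl2-refl i _ , wl2-refl i _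

    wl2-sym : ∀ i {a b} → wl2 G i a b → wl2 G i b a
    wl2-sym zero    (c₁ , c₂ , (e , e') , a) = sym c₁ , sym c₂ , (e' , e) , sym a
    wl2-sym (suc i) {a₁ , a₂} {b₁ , b₂} (h , π , m) = wl2-sym i h , Perm.flip π , λ w →
      subst (λ z → wl2 G i (z , b₂) (Inverse.from π w , a₂)) (Perm.inverseʳ π) (wl2-sym i (proj₁ (m (Inverse.from π w)))) ,
      subst (λ z → wl2 G i (b₁ , z) (a₁ , Inverse.from π w)) (Perm.inverseʳ π) (wl2-sym i (proj₂ (m (Inverse.from π w))))

    wl2-trans : ∀ i {a b c} → wl2 G i a b → wl2 G i b c → wl2 G i a c
    wl2-trans zero (c₁ , c₂ , (e , e') , a) (d₁ , d₂ , (f , f') , b) =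
      trans c₁ d₁ , trans c₂ d₂ , (f ∘ e , e' ∘ f') , trans a b
    wl2-trans (suc i) (h , π , p) (g , ρ , q) = wl2-trans i h g , π Perm.∘ₚ ρ , λ w →
      wl2-trans i (proj₁ (p w)) (proj₁ (q (Inverse.to π w))) ,
      wl2-trans i (proj₂ (p w)) (proj₂ (q (Inverse.to π w)))

    wl2-lower : ∀ {i j a b} → i ≤ j → wl2 G j a b → wl2 G i a b
    wl2-lower i≤j h = go (≤⇒≤′ i≤j) h
      where
      go : ∀ {i j a b} → i ≤′ j → wl2 G j a b → wl2 G i a b
      go ≤′-refl       h = h
      go (≤′-step i≤j) h = go i≤j (proj₁ h)

    -- Exchange the second entry for `w` itself. The matched pair has the same atomic type as
    -- `(w , w)`, so its entries agree, which forces `π` to send `w` to `w'`. One extra round thus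
    -- recovers the diagonal colour of an entry from the colour of a pair.
    wl2-diagonal : ∀ i {w x w' x'} → wl2 G (suc i) (w , x) (w' , x') → wl2 G i (w , w) (w' , w')
    wl2-diagonal i {w} {x} {w'} {x'} (_ , π , m) =
      subst (λ z → wl2 G i (w , w) (w' , z)) (sym w'≡πw) (proj₂ (m w))
      where
      w'≡πw : w' ≡ Inverse.to π w
      w'≡πw = proj₁ (proj₁ (proj₂ (proj₂ (wl2-lower z≤n (proj₂ (m w)))))) refl

    private
      -- Pairs of pairs are coded by a single index, so that stability of a round is decidable and
      -- the related pairs can be counted.
      K = (k * k) * (k * k)

      left right : Fin K → Pair G
      left  q = remQuot k (proj₁ (remQuot {k * k} (k * k) q))
      right q = remQuot k (proj₂ (remQuot {k * k} (k * k) q))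

      code : Pair G → Pair G → Fin K
      code (a₁ , a₂) (b₁ , b₂) = combine (combine a₁ a₂) (combine b₁ b₂)

      left-code : ∀ a b → left (code a b) ≡ a
      left-code (a₁ , a₂) (b₁ , b₂) =
        trans (cong (remQuot k ∘ proj₁) (remQuot-combine (combine a₁ a₂) (combine b₁ b₂))) (remQuot-combine a₁ a₂)

      right-code : ∀ a b → right (code a b) ≡ b
      right-code (a₁ , a₂) (b₁ , b₂) =
        trans (cong (remQuot k ∘ proj₂) (remQuot-combine (combine a₁ a₂) (combine b₁ b₂))) (remQuot-combine b₁ b₂)

      related : ℕ → Fin K → Bool
      related i q = does (wl2? i (left q) (right q))

    -- An unstable round separates some related pair, and rounds never merge, so the number of
    -- related pairs drops strictly.
    wl2-stabilizes : ∃[ r ] ∀ a b → wl2 G r a b → wl2 G (suc r) a b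
    wl2-stabilizes = r , λ a b h →
      subst₂ (wl2 G (suc r)) (left-code a b) (right-code a b)
        (stable (code a b) (subst₂ (wl2 G r) (sym (left-code a b)) (sym (right-code a b)) h))
      where
      Stable : ℕ → Set
      Stable r = ∀ q → wl2 G r (left q) (right q) → wl2 G (suc r) (left q) (right q)
      step? : ∀ r q → Dec (wl2 G r (left q) (right q) → wl2 G (suc r) (left q) (right q))
      step? r q = wl2? r _ _ →-dec wl2? (suc r) _ _
      drop : ∀ r → ¬ Stable r → count (related (suc r)) < count (related r)
      drop r unstable with ¬∀⟶∃¬ K _ (step? r) unstable
      ... | q , ¬step = count-strict (related (suc r)) (related r) q
        (λ q' e → dec-true (wl2? r _ _) (proj₁ (does-elim (wl2? (suc r) (left q') (right q')) e)))
        (dec-false (wl2? (suc r) _ _) (λ h → ¬step (λ _ → h)))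
        (dec-true (wl2? r _ _) holds)
        where
        holds : wl2 G r (left q) (right q)
        holds with wl2? r (left q) (right q)
        ... | yes h = h
        ... | no ¬h = ⊥-elim (¬step (λ h → ⊥-elim (¬h h)))
      found = descent Stable (λ r → all? (step? r)) (λ r → count (related r)) drop
      r = proj₁ found
      stable = proj₂ found

    abstract
      stableRound : ℕ
      stableRound = proj₁ wl2-stabilizes

      stableRound-stable : ∀ a b → wl2 G stableRound a b → wl2 G (suc stableRound) a b
      stableRound-stable = proj₂ wl2-stabilizes

    -- Once a round separates nothing, no later one does: its bijections serve again in the next
    -- round, because the pairs they match stay equivalent.
    stableRound-WL2≈ : ∀ a b → wl2 G stableRound a b → WL2≈ G a b
    stableRound-WL2≈ a b h i = wl2-lower (m≤m+n i stableRound) (later i h)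
      where
      preserved : ∀ j {a b} → wl2 G (j + stableRound) a b → wl2 G (suc j + stableRound) a b
      preserved zero    h           = stableRound-stable _ _ h
      preserved (suc j) h@(_ , π , m) = h , π , λ w → preserved j (proj₁ (m w)) , preserved j (proj₂ (m w))
      later : ∀ j {a b} → wl2 G stableRound a b → wl2 G (j + stableRound) a b
      later zero    h = h
      later (suc j) h = preserved j (later j h)

  -- Equitable partitions from stable colourings

  Equitable : ∀ {m k} → (Fin m → Fin m → Bool) → (Fin m → Fin k) → Set
  Equitable A κ = ∀ x y → κ x ≡ κ y → ∀ c →
    count (λ z → A x z ∧ (κ z ≐ c)) ≡ count (λ z → A y z ∧ (κ z ≐ c))

  record Refinement (G : ColGraph) : Set where
    field
      κ         : Fin (n G) → Fin (n G)
      isWL2     : IsWL2Coloring G (toℕ ∘ κ)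
      refines   : ∀ x y → κ x ≡ κ y → col G x ≡ col G y
      equitable : Equitable (adj G) κ

  module _ (G : ColGraph) where

    private
      r = stableRound G

      _~_ : Fin (n G) → Fin (n G) → Set
      x ~ y = wl2 G r (x , x) (y , y)

      classes : Σ (Fin (n G) → Fin (n G)) λ κ → ∀ x y → (κ x ≡ κ y) ⇔ (x ~ y)
      classes = classify _~_ (λ x y → wl2? G r (x , x) (y , y)) (λ x → wl2-refl G r (x , x))
        (λ {x} {y} → wl2-sym G r {x , x} {y , y}) (λ {x} {y} {z} → wl2-trans G r {x , x} {y , y} {z , z})

      κ : Fin (n G) → Fin (n G)
      κ = proj₁ classes

      to : ∀ x y → κ x ≡ κ y → WL2≈ G (x , x) (y , y)
      to x y e = stableRound-WL2≈ G _ _ (proj₁ (proj₂ classes x y) e)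

      from : ∀ x y → WL2≈ G (x , x) (y , y) → κ x ≡ κ y
      from x y h = proj₂ (proj₂ classes x y) (h r)

      κ-equitable : Equitable (adj G) κ
      -- Two rounds beyond `r`: the first supplies `π`, the second is spent by `wl2-diagonal` to see
      -- that `π` preserves vertex colours. Adjacency is preserved by the atomic type.
      κ-equitable x y e c with to x y e (suc (suc r))
      ... | _ , π , m = trans (count-cong same) (sym (sum-permute (λ z → 𝟙 (adj G y z ∧ (κ z ≐ c))) π))
        where
        same : ∀ z → (adj G x z ∧ (κ z ≐ c)) ≡ (adj G y (Inverse.to π z) ∧ (κ (Inverse.to π z) ≐ c))
        same z = cong₂ (λ a b → a ∧ (b ≐ c))
          (proj₂ (proj₂ (proj₂ (wl2-lower G {0} {suc r} {x , z} {y , Inverse.to π z} z≤n (proj₂ (m z))))))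
          (from z (Inverse.to π z) (stableRound-WL2≈ G _ _
            (wl2-diagonal G r {z} {x} {Inverse.to π z} {y} (proj₁ (m z)))))

    abstract
      refine : Refinement G
      refine = record
        { κ         = κ
        ; isWL2     = λ v w → (λ e → to v w (toℕ-injective e)) , (λ h → cong toℕ (from v w h))
        ; refines   = λ x y e → proj₁ (to x y e 0)
        ; equitable = κ-equitable
        }

  -- Manipulating IRC trees

  Depth≤ : ColGraph → ℕ → Set
  Depth≤ G k = Σ (IRC2 G) λ t → indDepth t ≤ k

  depth-mono : ∀ {G k l} → k ≤ l → Depth≤ G k → Depth≤ G l
  depth-mono k≤l (t , h) = t , ≤-trans h k≤l

  ≤maxFin : ∀ l (h : Fin l → ℕ) i → h i ≤ maxFin l h
  ≤maxFin (suc l) h zero    = m≤m⊔n _ _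
  ≤maxFin (suc l) h (suc i) = ≤-trans (≤maxFin l (h ∘ suc) i) (m≤n⊔m (h zero) _)

  maxFin≤ : ∀ l (h : Fin l → ℕ) k → (∀ i → h i ≤ k) → maxFin l h ≤ k
  maxFin≤ zero    h k b = z≤n
  maxFin≤ (suc l) h k b = ⊔-lub (b zero) (maxFin≤ l (h ∘ suc) k (b ∘ suc))

  freshColor : ColGraph → ℕ
  freshColor G = suc (maxFin (n G) (col G))

  freshColor-fresh : ∀ G v → col G v ≢ freshColor G
  freshColor-fresh G v e = <⇒≢ (s≤s (≤maxFin (n G) (col G) v)) e

  individualize : ∀ G → Fin (n G) → ColGraph
  individualize G v = recolor G (indiv G v (freshColor G))

  depth-individualize : ∀ {G k} v → Depth≤ (individualize G v) k → Depth≤ G (suc k)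
  depth-individualize {G} v (t , h) = d4 v (freshColor G) (freshColor-fresh G) t , s≤s h

  depth-refine : ∀ {G k} → Depth≤ (recolor G (toℕ ∘ Refinement.κ (refine G))) k → Depth≤ G k
  depth-refine {G} (t , h) = d1 _ (Refinement.isWL2 (refine G)) t , h

  Unique : ∀ {A : Set} {m} → (Fin m → A) → Fin m → Set
  Unique χ x = ∀ y → χ x ≡ χ y → x ≡ y

  individualize-unique : ∀ G v → Unique (col (individualize G v)) v
  individualize-unique G v y e with v Fin.≟ v | y Fin.≟ v
  ... | yes _  | yes y≡v = sym y≡v
  ... | yes _  | no _    = contradiction (sym e) (freshColor-fresh G y)
  ... | no v≢v | _       = contradiction refl v≢v

  individualize-refines : ∀ G v x y → col (individualize G v) x ≡ col (individualize G v) y → col G x ≡ col G y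
  individualize-refines G v x y e with x Fin.≟ v | y Fin.≟ v
  ... | yes refl | yes refl = refl
  ... | yes _    | no _     = contradiction (sym e) (freshColor-fresh G y)
  ... | no _     | yes _    = contradiction e (freshColor-fresh G x)
  ... | no _     | no _     = e

  individualizeAll : ∀ G → List (Fin (n G)) → Fin (n G) → ℕ
  individualizeAll G []       = col G
  individualizeAll G (x ∷ xs) = individualizeAll (individualize G x) xs

  depth-individualizeAll : ∀ {G k} xs → Depth≤ (recolor G (individualizeAll G xs)) k → Depth≤ G (length xs + k)
  depth-individualizeAll []       t = t
  depth-individualizeAll (x ∷ xs) t = depth-individualize x (depth-individualizeAll xs t)

  individualizeAll-unique : ∀ G xs x → x ∈ xs ⊎ Unique (col G) x → Unique (individualizeAll G xs) x
  individualizeAll-unique G []       x (inj₂ u) = u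
  individualizeAll-unique G (y ∷ xs) x (inj₁ (here refl)) =
    individualizeAll-unique (individualize G x) xs x (inj₂ (individualize-unique G x))
  individualizeAll-unique G (y ∷ xs) x (inj₁ (there x∈xs)) =
    individualizeAll-unique (individualize G y) xs x (inj₁ x∈xs)
  individualizeAll-unique G (y ∷ xs) x (inj₂ u) =
    individualizeAll-unique (individualize G y) xs x (inj₂ (λ z e → u z (individualize-refines G y x z e)))

  -- The number of neighbours in a singleton class is 0 or 1, so equality of these counts is
  -- equality of adjacency to its only vertex.
  equitable-at-unique : ∀ {m k} (A : Fin m → Fin m → Bool) (κ : Fin m → Fin k) → Equitable A κ →
    ∀ {x} → Unique κ x → ∀ y z → κ y ≡ κ z → A y x ≡ A z x
  equitable-at-unique A κ eq {x} u y z e = bool-ext (imp y z e) (imp z y (sym e))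
    where
    imp : ∀ y z → κ y ≡ κ z → A y x ≡ true → A z x ≡ true
    imp y z e ayx with count-∃ (λ w → A z w ∧ (κ w ≐ κ x))
      (≤-trans (count-positive (λ w → A y w ∧ (κ w ≐ κ x)) x (∧-intro ayx (≐-refl (κ x)))) (≤-reflexive (eq y z e (κ x))))
    ... | w , h rewrite u w (sym (≐-elim (∧-elimʳ {A z w} h))) = ∧-elimˡ h

  -- Cutting off a vertex set by individualization and one flip

  module _ (G : ColGraph) (S : Fin (n G) → Bool) where

    private
      k = n G

      S-list : List (Fin k)
      S-list = tabulate (proj₁ (enumerate S))

      G₁ : ColGraph
      G₁ = recolor G (individualizeAll G S-list)

      open Refinement (refine G₁)

      S-unique : ∀ x → S x ≡ true → Unique κ x
      S-unique x Sx y e = individualizeAll-unique G S-list x (inj₁ x∈S) y (refines x y e)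
        where
        x∈S : x ∈ S-list
        x∈S with proj₂ (proj₂ (proj₂ (enumerate S))) x Sx
        ... | i , refl = ∈-tabulate⁺ i

      touches : Fin k → Fin k → Bool
      touches x y = adj G x y ∧ (S x ∨ S y)

      _≐ℕ_ : ℕ → ℕ → Bool
      a ≐ℕ b = does (a ≟ b)

      -- Flips the pairs of classes joined by an edge with an end in `S`. One class of such a pair
      -- is a singleton in `S`, joined to the whole other class, so the flip deletes exactly these
      -- edges and leaves pairs outside `S` as they were.
      f : ℕ → ℕ → Bool
      f a b = some λ x → some λ y → touches x y ∧ ((toℕ (κ x) ≐ℕ a) ∧ (toℕ (κ y) ≐ℕ b))

      f-intro : ∀ x y → touches x y ≡ true → f (toℕ (κ x)) (toℕ (κ y)) ≡ true
      f-intro x y t = some-intro _ x (some-intro _ y (∧-intro t (∧-intro (dec-true (toℕ (κ x) ≟ _) refl) (dec-true (toℕ (κ y) ≟ _) refl))))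

      f-elim : ∀ a b → f a b ≡ true → ∃[ x ] ∃[ y ] touches x y ≡ true × toℕ (κ x) ≡ a × toℕ (κ y) ≡ b
      f-elim a b e with some-elim _ e
      ... | x , e' with some-elim _ e'
      ...   | y , h = x , y , ∧-elimˡ h ,
        does-elim (_ ≟ _) (∧-elimˡ {toℕ (κ x) ≐ℕ a} (∧-elimʳ {touches x y} h)) ,
        does-elim (_ ≟ _) (∧-elimʳ {toℕ (κ x) ≐ℕ a} (∧-elimʳ {touches x y} h))

      touches-sym : ∀ x y → touches x y ≡ true → touches y x ≡ true
      touches-sym x y t = ∧-intro (trans (adj-sym G y x) (∧-elimˡ t)) (swap (∨-elim {S x} (∧-elimʳ {adj G x y} t)))
        where
        swap : S x ≡ true ⊎ S y ≡ true → S y ∨ S x ≡ true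
        swap (inj₁ Sx) = ∨-introʳ {S y} Sx
        swap (inj₂ Sy) = ∨-introˡ Sy

      f-flip : ∀ a b → f a b ≡ true → f b a ≡ true
      f-flip a b e with f-elim a b e
      ... | x , y , t , refl , refl = f-intro y x (touches-sym x y t)

      f-sym : ∀ a b → f a b ≡ f b a
      f-sym a b = bool-ext (f-flip a b) (f-flip b a)

      G₂ : ColGraph
      G₂ = recolor G (toℕ ∘ κ)

      adj-transfer : ∀ x y y' → S x ≡ true → κ y ≡ κ y' → adj G x y ≡ adj G x y'
      adj-transfer x y y' Sx e = trans (adj-sym G x y)
        (trans (equitable-at-unique (adj G) κ equitable (S-unique x Sx) y y' e) (adj-sym G y' x))

      no-edge-at-S : ∀ x y → S x ≡ true → flipAdj G₂ f x y ≡ false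
      no-edge-at-S x y Sx with x Fin.≟ y
      ... | yes _ = refl
      ... | no _ with adj G x y in axy | f (toℕ (κ x)) (toℕ (κ y)) in fxy
      ...   | true  | true  = refl
      ...   | false | false = refl
      ...   | true  | false = ⊥-elim (true≢false (f-intro x y (∧-intro axy (∨-introˡ Sx))) fxy)
      ...   | false | true with f-elim _ _ fxy
      ...     | x₁ , y₁ , t , ex , ey with S-unique x Sx x₁ (toℕ-injective (sym ex))
      ...       | refl = ⊥-elim (true≢false
        (trans (sym (adj-transfer x y₁ y Sx (toℕ-injective ey))) (∧-elimˡ t)) axy)

      old-edge : ∀ x y → S x ≡ false → S y ≡ false → flipAdj G₂ f x y ≡ true → adj G x y ≡ true
      old-edge x y Sx Sy e with x Fin.≟ y
      ... | no _ with adj G x y | f (toℕ (κ x)) (toℕ (κ y)) in fxy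
      ...   | true  | _    = refl
      ...   | false | true with f-elim _ _ fxy
      ...     | x₁ , y₁ , t , ex , ey with ∨-elim {S x₁} (∧-elimʳ {adj G x₁ y₁} t)
      ...       | inj₁ s = ⊥-elim (true≢false (subst (λ z → S z ≡ true) (S-unique x₁ s x (toℕ-injective ex)) s) Sx)
      ...       | inj₂ s = ⊥-elim (true≢false (subst (λ z → S z ≡ true) (S-unique y₁ s y (toℕ-injective ey)) s) Sy)

    isolate : ColGraph
    isolate = flipG G₂ f f-sym

    isolate-edge : ∀ x y → adj isolate x y ≡ true → adj G x y ≡ true × S x ≡ false × S y ≡ false
    isolate-edge x y e = old-edge x y Sx Sy e , Sx , Sy
      where
      Sx : S x ≡ false
      Sx = ¬true⇒false (λ s → true≢false e (no-edge-at-S x y s))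
      Sy : S y ≡ false
      Sy = ¬true⇒false (λ s → true≢false e (trans (flipAdj-sym G₂ f f-sym x y) (no-edge-at-S y x s)))

    depth-isolate : ∀ {d} → Depth≤ isolate d → Depth≤ G (count S + d)
    depth-isolate {d} (t , h) = depth-mono (≤-reflexive (cong (_+ d) (length-tabulate (proj₁ (enumerate S)))))
      (depth-individualizeAll S-list (depth-refine {G₁} (d2 f f-sym t , h)))

  edgeless-depth : ∀ G → (∀ x y → adj G x y ≡ false) → Depth≤ G 0
  edgeless-depth G none =
    d3 (n G) point (λ i _ → i) isComponent (λ v → v , zero , refl) (λ i j x y e → e) (λ i → leaf refl) ,
    maxFin≤ (n G) _ 0 (λ i → ≤-refl)
    where
    point : Fin (n G) → ColGraph
    point i = record
      { n = 1 ; nonempty = ≤-refl ; adj = λ _ _ → false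
      ; adj-sym = λ _ _ → refl ; adj-irr = λ _ → refl ; col = λ _ → col G i }
    stays : ∀ {v w} → Reach G v w → v ≡ w
    stays here       = refl
    stays (step _ e) = ⊥-elim (true≢false e (none _ _))
    isComponent : ∀ i → IsComponent G (point i) (λ _ → i)
    isComponent i = record
      { inj       = λ { zero zero _ → refl }
      ; adj-pres  = λ _ _ → sym (none i i)
      ; col-pres  = λ _ → refl
      ; connected = λ _ _ → here
      ; closed    = λ _ w p → zero , stays p }

  -- Isolate all vertices. This crude bound finishes the components of bounded size and covers the
  -- graphs for which the threshold of the error term is 0.
  depth≤order : ∀ G → Depth≤ G (n G)
  depth≤order G = depth-mono (≤-reflexive (trans (+-identityʳ _) (count-true (n G))))
    (depth-isolate G (λ _ → true) (edgeless-depth (isolate G (λ _ → true))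
      (λ x y → ¬true⇒false (λ e → true≢false refl (proj₁ (proj₂ (isolate-edge G (λ _ → true) x y e)))))))

  -- Balls and connected components

  module Balls {m : ℕ} (A : Fin m → Fin m → Bool) where

    -- Only paths whose vertices after the start lie in `U` are followed; the center itself is not
    -- tested. In the carving, `U` is the part of the graph not yet cut away.
    ball : (Fin m → Bool) → Fin m → ℕ → Fin m → Bool
    ball U v zero    x = v ≐ x
    ball U v (suc r) x = ball U v r x ∨ (U x ∧ some (λ y → ball U v r y ∧ A y x))

    module _ {U : Fin m → Bool} {v : Fin m} where

      ball-center : ball U v 0 v ≡ true
      ball-center = ≐-refl v

      ball-suc : ∀ r {x} → ball U v r x ≡ true → ball U v (suc r) x ≡ true
      ball-suc r h = ∨-introˡ h

      ball-mono : ∀ {r s x} → r ≤ s → ball U v r x ≡ true → ball U v s x ≡ true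
      ball-mono r≤s h = go (≤⇒≤′ r≤s) h
        where
        go : ∀ {r s x} → r ≤′ s → ball U v r x ≡ true → ball U v s x ≡ true
        go ≤′-refl           h = h
        go (≤′-step {s} r≤s) h = ball-suc s (go r≤s h)

      ball-step : ∀ r {x y} → ball U v r y ≡ true → A y x ≡ true → U x ≡ true → ball U v (suc r) x ≡ true
      ball-step r {x} {y} by ayx ux = ∨-introʳ {ball U v r x} (∧-intro ux (some-intro _ y (∧-intro by ayx)))

      ball-inv : ∀ r {x} → ball U v (suc r) x ≡ true →
        ball U v r x ≡ true ⊎ U x ≡ true × ∃[ y ] ball U v r y ≡ true × A y x ≡ true
      ball-inv r {x} h with ∨-elim {ball U v r x} h
      ... | inj₁ b = inj₁ b
      ... | inj₂ e with some-elim _ (∧-elimʳ {U x} e)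
      ...   | y , g = inj₂ (∧-elimˡ e , y , ∧-elimˡ g , ∧-elimʳ {ball U v r y} g)

    everywhere : Fin m → Bool
    everywhere _ = true

    ball⊆ball : ∀ {U v} r {x} → ball U v r x ≡ true → ball everywhere v r x ≡ true
    ball⊆ball     zero    h = h
    ball⊆ball {U} {v} (suc r) h with ball-inv {U} {v} r h
    ... | inj₁ b                = ball-suc r (ball⊆ball r b)
    ... | inj₂ (_ , y , b , a) = ball-step r (ball⊆ball r b) a refl

    ball-trans : ∀ {v w x} r s → ball everywhere v r w ≡ true → ball everywhere w s x ≡ true → ball everywhere v (r + s) x ≡ true
    ball-trans {v} {w} r zero    p q rewrite ≐-elim q | +-identityʳ r = p
    ball-trans {v} {w} r (suc s) p q rewrite +-suc r s with ball-inv {everywhere} {w} s q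
    ... | inj₁ b                = ball-suc (r + s) (ball-trans r s p b)
    ... | inj₂ (_ , y , b , a) = ball-step (r + s) (ball-trans r s p b) a refl

    ball-sym : (∀ x y → A x y ≡ A y x) → ∀ {v x} r → ball everywhere v r x ≡ true → ball everywhere x r v ≡ true
    ball-sym A-sym {v} {x} zero    p = ≐-intro (sym (≐-elim p))
    ball-sym A-sym {v} {x} (suc r) p with ball-inv {everywhere} {v} r p
    ... | inj₁ b                = ball-suc r (ball-sym A-sym r b)
    ... | inj₂ (_ , y , b , a) = ball-trans 1 r (ball-step 0 (≐-refl x) (trans (A-sym x y) a) refl) (ball-sym A-sym r b)

    ball-closes : ∀ v → ∃[ r ] ∀ x → ball everywhere v (suc r) x ≡ true → ball everywhere v r x ≡ true
    ball-closes v = descent Closed (λ r → all? (step? r)) (λ r → m ∸ count (ball everywhere v r)) drop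
      where
      Closed : ℕ → Set
      Closed r = ∀ x → ball everywhere v (suc r) x ≡ true → ball everywhere v r x ≡ true
      step? : ∀ r x → Dec (ball everywhere v (suc r) x ≡ true → ball everywhere v r x ≡ true)
      step? r x = (_ ≟ᵇ true) →-dec (_ ≟ᵇ true)
      drop : ∀ r → ¬ Closed r → m ∸ count (ball everywhere v (suc r)) < m ∸ count (ball everywhere v r)
      drop r open' with ¬∀⟶∃¬ m _ (step? r) open'
      ... | x , ¬step with ¬imp⇒ ¬step
      ...   | b , b' = ∸-monoʳ-< (count-strict (ball everywhere v r) (ball everywhere v (suc r)) x (λ x → ball-suc r) b' b)
                                 (count≤size (ball everywhere v (suc r)))

  module _ (G : ColGraph) where

    open Balls (adj G)

    reach-trans : ∀ {x y z} → Reach G x y → Reach G y z → Reach G x z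
    reach-trans p here       = p
    reach-trans p (step q e) = step (reach-trans p q) e

    reach-sym : ∀ {x y} → Reach G x y → Reach G y x
    reach-sym here               = here
    reach-sym (step {w} {u} p e) = reach-trans (step here (trans (adj-sym G u w) e)) (reach-sym p)

    ball⇒reach : ∀ {v} r {x} → ball everywhere v r x ≡ true → Reach G v x
    ball⇒reach     zero    h rewrite ≐-elim h = here
    ball⇒reach {v} (suc r) h with ball-inv {everywhere} {v} r h
    ... | inj₁ b                = ball⇒reach r b
    ... | inj₂ (_ , y , b , a) = step (ball⇒reach r b) a

    reach? : ∀ v x → Dec (Reach G v x)
    reach? v x = map′ (ball⇒reach r) reach⇒ball (ball everywhere v r x ≟ᵇ true)
      where
      r = proj₁ (ball-closes v)
      reach⇒ball : ∀ {x} → Reach G v x → ball everywhere v r x ≡ true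
      reach⇒ball here       = ball-mono {everywhere} {v} {0} {r} z≤n (ball-center {everywhere})
      reach⇒ball (step p e) = proj₂ (ball-closes v) _ (ball-step r (reach⇒ball p) e refl)

    -- A component node costs the maximum over its children, so the number of components does not
    -- enter. Smallness is asked of some Boolean superset `p` of the component, which the carving
    -- supplies directly.
    components-depth : ∀ M → (∀ v → ∃[ p ] (∀ x → Reach G v x → p x ≡ true) × count p ≤ M) → Depth≤ G M
    components-depth M small =
      d3 (count used) H ι isComponent cover disjoint (λ i → proj₁ (depth≤order (H i))) ,
      maxFin≤ (count used) _ M (λ i → ≤-trans (proj₂ (depth≤order (H i))) (size≤M i))
      where
      classes : Σ (Fin (n G) → Fin (n G)) λ κ → ∀ x y → (κ x ≡ κ y) ⇔ Reach G x y
      classes = classify (Reach G) reach? (λ x → here) reach-sym reach-trans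
      κ : Fin (n G) → Fin (n G)
      κ = proj₁ classes
      used : Fin (n G) → Bool
      used c = some (λ x → κ x ≐ c)
      rep : Fin (count used) → Fin (n G)
      rep = proj₁ (enumerate used)
      part : Fin (count used) → Fin (n G) → Bool
      part i x = κ x ≐ rep i
      witness : ∀ i → ∃[ x ] part i x ≡ true
      witness i = some-elim _ (proj₁ (proj₂ (proj₂ (enumerate used))) i)
      ι : (i : Fin (count used)) → Fin (count (part i)) → Fin (n G)
      ι i = proj₁ (enumerate (part i))
      ι-inj : ∀ i x y → ι i x ≡ ι i y → x ≡ y
      ι-inj i = proj₁ (proj₂ (enumerate (part i)))
      κι : ∀ i x → κ (ι i x) ≡ rep i
      κι i x = ≐-elim (proj₁ (proj₂ (proj₂ (enumerate (part i)))) x)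
      ι-onto : ∀ i v → κ v ≡ rep i → ∃[ x ] ι i x ≡ v
      ι-onto i v e = proj₂ (proj₂ (proj₂ (enumerate (part i)))) v (≐-intro e)
      H : Fin (count used) → ColGraph
      H i = record
        { n        = count (part i)
        ; nonempty = count-positive (part i) (proj₁ (witness i)) (proj₂ (witness i))
        ; adj      = λ x y → adj G (ι i x) (ι i y)
        ; adj-sym  = λ x y → adj-sym G (ι i x) (ι i y)
        ; adj-irr  = λ x → adj-irr G (ι i x)
        ; col      = λ x → col G (ι i x) }
      isComponent : ∀ i → IsComponent G (H i) (ι i)
      isComponent i = record
        { inj       = ι-inj i
        ; adj-pres  = λ _ _ → refl
        ; col-pres  = λ _ → refl
        ; connected = λ x y → proj₁ (proj₂ classes _ _) (trans (κι i x) (sym (κι i y)))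
        ; closed    = λ x w p → ι-onto i w (trans (sym (proj₂ (proj₂ classes _ _) p)) (κι i x)) }
      cover : ∀ v → ∃[ i ] ∃[ x ] ι i x ≡ v
      cover v with proj₂ (proj₂ (proj₂ (enumerate used))) (κ v) (some-intro _ v (≐-refl (κ v)))
      ... | i , e = i , ι-onto i v (sym e)
      disjoint : ∀ i j x y → ι i x ≡ ι j y → i ≡ j
      disjoint i j x y e = proj₁ (proj₂ (enumerate used)) i j (trans (sym (κι i x)) (trans (cong κ e) (κι j y)))
      size≤M : ∀ i → count (part i) ≤ M
      size≤M i with witness i
      ... | v , e with small v
      ...   | p , reach⊆p , p≤M = ≤-trans (count-mono (λ x h →
        reach⊆p x (proj₁ (proj₂ classes v x) (trans (≐-elim e) (sym (≐-elim h)))))) p≤M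

  -- Potentials of colourings

  Refines : ∀ {m k l} → (Fin m → Fin k) → (Fin m → Fin l) → Set
  Refines κ' κ = ∀ x y → κ' x ≡ κ' y → κ x ≡ κ y

  numClasses : ∀ {m k} → (Fin m → Fin k) → ℕ
  numClasses κ = count (λ c → some (λ x → κ x ≐ c))

  -- Deleting the κ'-classes of the ws still leaves a κ'-class inside every κ-class.
  record Removable {m k l} (κ : Fin m → Fin k) (κ' : Fin m → Fin l) (ws : List (Fin m)) : Set where
    field
      distinct : AllPairs (λ w w' → κ' w ≢ κ' w') ws
      mates    : All (λ w → ∃[ u ] κ u ≡ κ w × All (λ w' → κ' u ≢ κ' w') ws) ws

  -- Map each `κ`-class to a `κ'`-class inside it that is not deleted. This is injective because
  -- `κ'` refines `κ`, and the deleted classes, one for each entry of `ws`, come on top of its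
  -- image.
  numClasses-grows : ∀ {m} (κ κ' : Fin m → Fin m) ws → Refines κ' κ → Removable κ κ' ws →
    numClasses κ + length ws ≤ numClasses κ'
  numClasses-grows {m} κ κ' ws fine rem = begin
    numClasses κ + length ws                                 ≤⟨ +-mono-≤ survivors (removed≥ ws distinct) ⟩
    count (λ c → used c ∧ not (removed ws c)) + count (removed ws) ≤⟨ count-disjoint _ (removed ws) used (λ c → ∧-elimˡ)
                                                                  (removed-used ws) (λ c s r → true≢false r (not-elim (∧-elimʳ {used c} s))) ⟩
    numClasses κ'                                            ∎
    where
    open ≤-Reasoning
    open Removable rem
    used : Fin m → Bool
    used c = some (λ x → κ' x ≐ c)
    removed : List (Fin m) → Fin m → Bool
    removed []       c = false
    removed (w ∷ ws) c = (κ' w ≐ c) ∨ removed ws c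
    removed-used : ∀ ws c → removed ws c ≡ true → used c ≡ true
    removed-used (w ∷ ws) c r with ∨-elim {κ' w ≐ c} r
    ... | inj₁ e = some-intro _ w e
    ... | inj₂ r = removed-used ws c r
    removed-avoids : ∀ {ws c} → All (λ w → c ≢ κ' w) ws → removed ws c ≡ false
    removed-avoids []               = refl
    removed-avoids {w ∷ ws} {c} (c≢ ∷ rest) = ¬true⇒false λ r → case (∨-elim {κ' w ≐ c} r)
      where
      case : (κ' w ≐ c) ≡ true ⊎ removed ws c ≡ true → ⊥
      case (inj₁ e) = c≢ (sym (≐-elim e))
      case (inj₂ r) = true≢false r (removed-avoids rest)
    removed-member : ∀ {ws c} → removed ws c ≡ true → ∃[ w ] w ∈ ws × κ' w ≡ c
    removed-member {w ∷ ws} {c} r with ∨-elim {κ' w ≐ c} r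
    ... | inj₁ e = w , here refl , ≐-elim e
    ... | inj₂ r with removed-member r
    ...   | w' , w'∈ , e = w' , there w'∈ , e
    removed≥ : ∀ ws → AllPairs (λ w w' → κ' w ≢ κ' w') ws → length ws ≤ count (removed ws)
    removed≥ []       _ = z≤n
    removed≥ (w ∷ ws) (w≢ ∷ rest) = ≤-trans (+-mono-≤ (≤-reflexive (sym (count-≐ (κ' w)))) (removed≥ ws rest))
      (count-disjoint (κ' w ≐_) (removed ws) (removed (w ∷ ws)) (λ c → ∨-introˡ) (λ c → ∨-introʳ {κ' w ≐ c})
        (λ c e r → true≢false (subst (λ c → removed ws c ≡ true) (sym (≐-elim e)) r) (removed-avoids w≢)))
    kept : Fin m → Fin m → Bool
    kept c y = (κ y ≐ c) ∧ not (removed ws (κ' y))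
    kept-exists : ∀ x → ∃[ y ] kept (κ x) y ≡ true
    kept-exists x with removed ws (κ' x) in r
    ... | false = x , ∧-intro (≐-refl (κ x)) (not-intro r)
    -- The class of `x` is deleted, being that of some `w` in the list. A mate of `w` takes over; it
    -- has the `κ`-colour of `x` by refinement.
    ... | true with removed-member r
    ...   | w , w∈ , e with All.lookup mates w∈
    ...     | u , κu≡κw , u≢ = u , ∧-intro (≐-intro (trans κu≡κw (fine w x e))) (not-intro (removed-avoids u≢))
    survivor : Fin m → Fin m
    survivor c with any? (λ y → kept c y ≟ᵇ true)
    ... | yes (y , _) = κ' y
    ... | no _        = c
    survivor-spec : ∀ c → some (λ x → κ x ≐ c) ≡ true → ∃[ y ] kept c y ≡ true × survivor c ≡ κ' y
    survivor-spec c u with any? (λ y → kept c y ≟ᵇ true)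
    ... | yes (y , h) = y , h , refl
    ... | no none with some-elim _ u
    ...   | x , e with kept-exists x
    ...     | y , h = ⊥-elim (none (y , subst (λ c → kept c y ≡ true) (≐-elim e) h))
    survivors : numClasses κ ≤ count (λ c → used c ∧ not (removed ws c))
    survivors = count-injection _ _ survivor valid injective
      where
      valid : ∀ c → some (λ x → κ x ≐ c) ≡ true → used (survivor c) ∧ not (removed ws (survivor c)) ≡ true
      valid c u with survivor-spec c u
      ... | y , h , e rewrite e = ∧-intro (some-intro _ y (≐-refl (κ' y))) (∧-elimʳ {κ y ≐ c} h)
      injective : ∀ c c' → some (λ x → κ x ≐ c) ≡ true → some (λ x → κ x ≐ c') ≡ true → survivor c ≡ survivor c' → c ≡ c'
      injective c c' u u' e with survivor-spec c u | survivor-spec c' u'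
      ... | y , h , s | y' , h' , s' = trans (sym (≐-elim (∧-elimˡ h)))
        (trans (fine y y' (trans (sym s) (trans e s'))) (≐-elim (∧-elimˡ h')))

  module _ {m : ℕ} (d : ℕ) where

    -- The potential that pays for balanced splits. Truncated subtraction is superadditive, so
    -- refining never raises it, and a split into two parts of size at least `d` lowers it by `d`.
    excess : (Fin m → Fin m) → ℕ
    excess κ = sum (λ c → count (λ x → κ x ≐ c) ∸ d)

    excess≤size : ∀ κ → excess κ ≤ m
    excess≤size κ = begin
      sum (λ c → count (λ x → κ x ≐ c) ∸ d)        ≤⟨ sum-mono-≤ class≤ ⟩
      sum (λ c → count (λ x → (κ x ≐ c) ∧ true))   ≡⟨ count-fibres κ (λ _ → true) ⟩
      count {m} (λ _ → true)                       ≡⟨ count-true m ⟩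
      m                                            ∎
      where
      open ≤-Reasoning
      class≤ : ∀ c → count (λ x → κ x ≐ c) ∸ d ≤ count (λ x → (κ x ≐ c) ∧ true)
      class≤ c = ≤-trans (m∸n≤m (count (λ x → κ x ≐ c)) d) (count-mono {p = λ x → κ x ≐ c} (λ x e → ∧-intro e refl))

    module _ (κ κ' : Fin m → Fin m) (fine : Refines κ' κ) (β : Fin m → Bool) (β-inv : ∀ x y → κ' x ≡ κ' y → β x ≡ β y) where

      private
        pos neg : Fin m → Fin m → Bool
        pos c x = (κ x ≐ c) ∧ β x
        neg c x = (κ x ≐ c) ∧ not (β x)

        part : (Fin m → Fin m → Bool) → Fin m → Fin m → ℕ
        part q c' c = count (λ x → (κ' x ≐ c') ∧ q c x) ∸ d

      -- A non-empty `κ'`-class lies in one half of one `κ`-class, because `β` is constant on it;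
      -- that single summand already suffices.
      class-excess≤ : ∀ c' → count (λ x → κ' x ≐ c') ∸ d ≤ sum (λ c → part pos c' c + part neg c' c)
      class-excess≤ c' with any? (λ x → (κ' x ≐ c') ≟ᵇ true)
      ... | no none = ≤-trans (≤-reflexive (trans (cong (_∸ d) (count-zero _ (λ x → ¬true⇒false (λ e → none (x , e))))) (0∸n≡0 d))) z≤n
      ... | yes (x , e) = ≤-trans inside (term≤sum _ (κ x))
        where
        κ≡ : ∀ y → (κ' y ≐ c') ≡ true → κ' x ≡ κ' y
        κ≡ y e' = trans (≐-elim e) (sym (≐-elim e'))
        inside : count (λ y → κ' y ≐ c') ∸ d ≤ part pos c' (κ x) + part neg c' (κ x)
        inside with β x in b
        ... | true  = ≤-trans (∸-monoˡ-≤ d (count-mono (λ y e' → ∧-intro e' (∧-intro (≐-intro (sym (fine x y (κ≡ y e'))))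
                        (trans (sym (β-inv x y (κ≡ y e'))) b))))) (m≤m+n _ _)
        ... | false = ≤-trans (∸-monoˡ-≤ d (count-mono (λ y e' → ∧-intro e' (∧-intro (≐-intro (sym (fine x y (κ≡ y e'))))
                        (not-intro (trans (sym (β-inv x y (κ≡ y e'))) b)))))) (m≤n+m _ (part pos c' (κ x)))

      -- The right side is the excess of the common refinement of `κ` with the two-valued colouring
      -- `β`, which `κ'` refines in turn.
      excess-split : excess κ' ≤ sum (λ c → (count (pos c) ∸ d) + (count (neg c) ∸ d))
      excess-split = begin
        excess κ'                                                      ≤⟨ sum-mono-≤ class-excess≤ ⟩
        sum (λ c' → sum (λ c → part pos c' c + part neg c' c))         ≡⟨ ∑-comm (λ c' c → part pos c' c + part neg c' c) ⟩
        sum (λ c → sum (λ c' → part pos c' c + part neg c' c))         ≡⟨ sum-cong-≗ (λ c → ∑-distrib-+ (λ c' → part pos c' c) (λ c' → part neg c' c)) ⟩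
        sum (λ c → sum (λ c' → part pos c' c) + sum (λ c' → part neg c' c)) ≤⟨ sum-mono-≤ (λ c → +-mono-≤ (merge pos c) (merge neg c)) ⟩
        sum (λ c → (count (pos c) ∸ d) + (count (neg c) ∸ d))          ∎
        where
        open ≤-Reasoning
        merge : ∀ q c → sum (λ c' → part q c' c) ≤ count (q c) ∸ d
        merge q c = ≤-trans (sum-∸ (λ c' → count (λ x → (κ' x ≐ c') ∧ q c x)) d) (≤-reflexive (cong (_∸ d) (count-fibres κ' (q c))))

      private
        halves : ∀ c → (count (pos c) ∸ d) + (count (neg c) ∸ d) ≤ count (λ x → κ x ≐ c) ∸ d
        halves c = ≤-trans (∸-superadditive d (count (pos c)) (count (neg c))) (≤-reflexive (cong (_∸ d) (sym (count-split _ β))))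

      excess-mono : excess κ' ≤ excess κ
      excess-mono = ≤-trans excess-split (sum-mono-≤ halves)

      excess-drop : ∀ c → d ≤ count (pos c) → d ≤ count (neg c) → excess κ' + d ≤ excess κ
      excess-drop c p q = ≤-trans (+-monoˡ-≤ d excess-split) (sum-mono-drop c halves
        (≤-trans (∸-superadditive-strict p q) (≤-reflexive (cong (_∸ d) (sym (count-split _ β))))))

  -- Ball carving

  -- This is `2h` for `h = d * (5 * T)`. If every sphere were too large, balls would have at least
  -- `h` vertices from radius `h` on, and each of the next `h` spheres more than `5 * T`. That
  -- exceeds `(4h + 1) * T`, the growth bound at radius `2h`.
  carveRadius : ℕ → ℕ → ℕ
  carveRadius d T = d * (5 * T) + d * (5 * T)

  pieceBound : ℕ → ℕ → ℕ
  pieceBound d T = suc (2 * carveRadius d T) * T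

  -- If every increment exceeded b/d, then b would grow linearly at first and hence quadratically.
  abstract
    small-increment : ∀ d T → 1 ≤ d → 1 ≤ T → (b s : ℕ → ℕ) → (∀ r → b (suc r) ≡ b r + s r) → 1 ≤ b 0 →
      (∀ r → b r ≤ suc (2 * r) * T) → ∃[ r ] r < carveRadius d T × d * s r ≤ b r
    small-increment d T 1≤d 1≤T b s b-suc 1≤b₀ growth with anyUpTo? (λ r → d * s r ≤? b r) (carveRadius d T)
    ... | yes found = found
    ... | no none   = ⊥-elim (<⇒≱ too-large (growth (h + h)))
      where
      open ≤-Reasoning
      q : ℕ
      q = 5 * T
      h : ℕ
      h = d * q
      1≤h : 1 ≤ h
      1≤h = *-mono-≤ 1≤d (≤-trans 1≤T (m≤m+n T _))
      steep : ∀ {r} → r < h + h → b r < d * s r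
      steep r< = ≰⇒> (λ small → none (_ , r< , small))
      increment : ∀ {r k} → r < h + h → d * k ≤ b r → k < s r
      increment r< k≤ = *-cancelˡ-< d _ _ (≤-<-trans k≤ (steep r<))
      linear : ∀ r → r ≤ h + h → suc r ≤ b r
      linear zero    _  = 1≤b₀
      linear (suc r) r< = begin
        2 + r       ≡⟨ +-comm 1 (suc r) ⟩
        suc r + 1   ≤⟨ +-mono-≤ (linear r (<⇒≤ r<)) (increment r< (≤-trans (≤-reflexive (*-zeroʳ d)) z≤n)) ⟩
        b r + s r   ≡⟨ b-suc r ⟨
        b (suc r)   ∎
      quadratic : ∀ j → j ≤ h → j * suc q ≤ b (h + j)
      quadratic zero    _  = z≤n
      quadratic (suc j) j< = begin
        suc q + j * suc q       ≡⟨ +-comm (suc q) _ ⟩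
        j * suc q + suc q       ≤⟨ +-mono-≤ (quadratic j (<⇒≤ j<)) (increment h+j< (≤-trans (≤-trans (m≤m+n h j) (n≤1+n _)) (linear (h + j) (<⇒≤ h+j<)))) ⟩
        b (h + j) + s (h + j)   ≡⟨ b-suc (h + j) ⟨
        b (suc (h + j))         ≡⟨ cong b (+-suc h j) ⟨
        b (h + suc j)           ∎
        where
        h+j< : h + j < h + h
        h+j< = +-monoʳ-< h j<
      too-large : suc (2 * (h + h)) * T < b (h + h)
      too-large = begin-strict
        suc (2 * (h + h)) * T    ≡⟨ solve 2 (λ h T → (con 1 :+ con 2 :* (h :+ h)) :* T := con 4 :* (h :* T) :+ con 1 :* T) refl h T ⟩
        4 * (h * T) + 1 * T      ≤⟨ +-monoʳ-≤ (4 * (h * T)) (*-monoˡ-≤ T 1≤h) ⟩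
        4 * (h * T) + h * T      <⟨ m<m+n _ 1≤h ⟩
        4 * (h * T) + h * T + h  ≡⟨ solve 2 (λ h T → con 4 :* (h :* T) :+ h :* T :+ h := h :* (con 1 :+ con 5 :* T)) refl h T ⟩
        h * suc q                ≤⟨ quadratic h ≤-refl ⟩
        b (h + h)                ∎
        where open +-*-Solver

  module Carving {m : ℕ} (A : Fin m → Fin m → Bool) (A-sym : ∀ x y → A x y ≡ A y x) (d T : ℕ) (1≤d : 1 ≤ d) (1≤T : 1 ≤ T)
    (growth : ∀ v r → count (Balls.ball A (Balls.everywhere A) v r) ≤ suc (2 * r) * T) where

    open Balls A

    -- `S` is the separator and `p` numbers the pieces it leaves. Numbers stay below `bound` so that
    -- the next piece can take `bound` itself as a fresh number.
    record Carved (U : Fin m → Bool) (bound : ℕ) : Set where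
      field
        S       : Fin m → Bool
        p       : Fin m → ℕ
        S-small : d * count S ≤ count U
        p-bound : ∀ x → U x ≡ true → S x ≡ false → p x < bound
        p-edge  : ∀ x y → U x ≡ true → U y ≡ true → S x ≡ false → S y ≡ false → A x y ≡ true → p x ≡ p y
        p-small : ∀ v → U v ≡ true → S v ≡ false → ∃[ q ]
                  (∀ x → U x ≡ true → S x ≡ false → p x ≡ p v → q x ≡ true) × count q ≤ pieceBound d T

    sphere : (Fin m → Bool) → Fin m → ℕ → Fin m → Bool
    sphere U v r x = ball U v (suc r) x ∧ not (ball U v r x)

    abstract
      carving-radius : ∀ U v → ∃[ r ] r < carveRadius d T × d * count (sphere U v r) ≤ count (ball U v r)
      carving-radius U v = small-increment d T 1≤d 1≤T (λ r → count (ball U v r)) (λ r → count (sphere U v r)) ball-grows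
        (count-positive (ball U v 0) v (ball-center {U} {v}))
        (λ r → ≤-trans (count-mono {p = ball U v r} (λ x → ball⊆ball {U} {v} r)) (growth v r))
        where
        ball-grows : ∀ r → count (ball U v (suc r)) ≡ count (ball U v r) + count (sphere U v r)
        ball-grows r = trans (count-split (ball U v (suc r)) (ball U v r)) (cong (_+ count (sphere U v r)) (count-cong (λ x →
          bool-ext (λ e → ∧-elimʳ {ball U v (suc r) x} e) (λ e → ∧-intro (ball-suc {U} {v} r {x} e) e))))

    module CarveStep (fuel : ℕ) (U : Fin m → Bool) (v : Fin m) (Uv : U v ≡ true) (r : ℕ) (r< : r < carveRadius d T)
      (sphere-small : d * count (sphere U v r) ≤ count (ball U v r))
      (rest : Carved (λ x → U x ∧ not (ball U v (suc r) x)) fuel) where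

      private
        module R = Carved rest

        B U' : Fin m → Bool
        B    = ball U v r
        U' x = U x ∧ not (ball U v (suc r) x)

      ball⊆U : ∀ r {x} → ball U v r x ≡ true → U x ≡ true
      ball⊆U zero    h = subst (λ x → U x ≡ true) (≐-elim h) Uv
      ball⊆U (suc r) h with ball-inv {U} {v} r h
      ... | inj₁ b        = ball⊆U r b
      ... | inj₂ (ux , _) = ux

      S : Fin m → Bool
      S x = sphere U v r x ∨ R.S x

      -- The new ball gets the number `fuel`, above all numbers used in the rest by `R.p-bound`.
      p : Fin m → ℕ
      p x = if B x then fuel else R.p x

      p-inside : ∀ x → B x ≡ true → p x ≡ fuel
      p-inside x b rewrite b = refl

      p-outside : ∀ x → B x ≡ false → p x ≡ R.p x
      p-outside x b rewrite b = refl

      outside : ∀ x → U x ≡ true → S x ≡ false → B x ≡ false → U' x ≡ true × R.S x ≡ false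
      outside x ux sx bx =
        ∧-intro ux (not-intro (¬true⇒false (λ b⁺ → true≢false (∨-introˡ {sphere U v r x} (∧-intro b⁺ (not-intro bx))) sx))) ,
        ¬true⇒false (λ s → true≢false (∨-introʳ {sphere U v r x} s) sx)

      -- The new sphere is charged to the ball it encloses. Ball and remaining set are disjoint, so
      -- no vertex is charged twice.
      S-small : d * count S ≤ count U
      S-small = begin
        d * count S                               ≤⟨ *-monoʳ-≤ d (count-∨ (sphere U v r) R.S) ⟩
        d * (count (sphere U v r) + count R.S)        ≡⟨ *-distribˡ-+ d (count (sphere U v r)) (count R.S) ⟩
        d * count (sphere U v r) + d * count R.S      ≤⟨ +-mono-≤ (sphere-small) R.S-small ⟩
        count B + count U'                        ≤⟨ count-disjoint B U' U (λ x → ball⊆U r) (λ x → ∧-elimˡ)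
                                                       (λ x b u' → true≢false (ball-suc {U} {v} r {x} b) (not-elim (∧-elimʳ {U x} u'))) ⟩
        count U                                   ∎
        where open ≤-Reasoning

      p-bound : ∀ x → U x ≡ true → S x ≡ false → p x < suc fuel
      p-bound x ux sx with B x ≟ᵇ true
      ... | yes bx = ≤-reflexive (cong suc (p-inside x bx))
      ... | no ¬bx with outside x ux sx (¬true⇒false ¬bx)
      ...   | u'x , s'x = ≤-trans (≤-reflexive (cong suc (p-outside x (¬true⇒false ¬bx)))) (m≤n⇒m≤1+n (R.p-bound x u'x s'x))

      -- An edge leaving the ball inside `U` ends in the sphere, which belongs to `S`.
      B-closed : ∀ x y → U y ≡ true → S y ≡ false → B x ≡ true → A x y ≡ true → B y ≡ true
      B-closed x y uy sy bx a with B y ≟ᵇ true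
      ... | yes by = by
      ... | no ¬by = ⊥-elim (true≢false (∨-introˡ {sphere U v r y}
        (∧-intro (ball-step {U} {v} r bx a uy) (not-intro (¬true⇒false ¬by)))) sy)

      p-edge : ∀ x y → U x ≡ true → U y ≡ true → S x ≡ false → S y ≡ false → A x y ≡ true → p x ≡ p y
      p-edge x y ux uy sx sy a with B x ≟ᵇ true
      ... | yes bx = trans (p-inside x bx) (sym (p-inside y (B-closed x y uy sy bx a)))
      ... | no ¬bx = trans (p-outside x bx) (trans (R.p-edge x y (proj₁ ox) (proj₁ oy) (proj₂ ox) (proj₂ oy) a) (sym (p-outside y by)))
        where
        bx : B x ≡ false
        bx = ¬true⇒false ¬bx
        by : B y ≡ false
        by = ¬true⇒false (λ b → ¬bx (B-closed y x ux sx b (trans (A-sym y x) a)))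
        ox = outside x ux sx bx
        oy = outside y uy sy by

      B-small : count B ≤ pieceBound d T
      B-small = ≤-trans (count-mono {p = B} (λ x → ball⊆ball {U} {v} r)) (≤-trans (growth v r)
        (*-monoˡ-≤ T (s≤s (*-monoʳ-≤ 2 (<⇒≤ (r<))))))

      p-small : ∀ w → U w ≡ true → S w ≡ false → ∃[ q ]
        (∀ x → U x ≡ true → S x ≡ false → p x ≡ p w → q x ≡ true) × count q ≤ pieceBound d T
      p-small w uw sw with B w ≟ᵇ true
      ... | yes bw = B , inside , B-small
        where
        inside : ∀ x → U x ≡ true → S x ≡ false → p x ≡ p w → B x ≡ true
        inside x ux sx e with B x ≟ᵇ true
        ... | yes bx = bx
        ... | no ¬bx with outside x ux sx (¬true⇒false ¬bx)
        ...   | u'x , s'x = ⊥-elim (<⇒≢ (R.p-bound x u'x s'x)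
          (trans (sym (p-outside x (¬true⇒false ¬bx))) (trans e (p-inside w bw))))
      ... | no ¬bw with outside w uw sw (¬true⇒false ¬bw)
      ...   | u'w , s'w with R.p-small w u'w s'w
      ...     | q , same , q≤ = q , same' , q≤
        where
        same' : ∀ x → U x ≡ true → S x ≡ false → p x ≡ p w → q x ≡ true
        same' x ux sx e with B x ≟ᵇ true
        ... | yes bx = ⊥-elim (<⇒≢ (R.p-bound w u'w s'w)
          (trans (sym (p-outside w (¬true⇒false ¬bw))) (trans (sym e) (p-inside x bx))))
        ... | no ¬bx with outside x ux sx (¬true⇒false ¬bx)
        ...   | u'x , s'x = same x u'x s'x (trans (sym (p-outside x (¬true⇒false ¬bx))) (trans e (p-outside w (¬true⇒false ¬bw))))

      carved : Carved U (suc fuel)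
      carved = record
        { S = S ; p = p ; S-small = S-small ; p-bound = p-bound ; p-edge = p-edge ; p-small = p-small }

    abstract
      carve : ∀ fuel U → count U ≤ fuel → Carved U fuel
      carve fuel U U≤ with any? (λ x → U x ≟ᵇ true)
      ... | no none = record
        { S = λ _ → false ; p = λ _ → 0 ; S-small = ≤-trans (≤-reflexive (trans (cong (d *_) (count-zero {m} _ (λ _ → refl))) (*-zeroʳ d))) z≤n
        ; p-bound = λ x ux _ → ⊥-elim (none (x , ux)) ; p-edge = λ _ _ _ _ _ _ _ → refl
        ; p-small = λ v uv → ⊥-elim (none (v , uv)) }
      carve zero       U U≤ | yes (v , Uv) = contradiction (count-positive U v Uv) (<⇒≱ (s≤s U≤))
      carve (suc fuel) U U≤ | yes (v , Uv) with carving-radius U v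
      ... | r , r< , small = CarveStep.carved fuel U v Uv r r< small (carve fuel _ (≤-pred (≤-trans fewer U≤)))
        where
        fewer : count (λ x → U x ∧ not (ball U v (suc r) x)) < count U
        fewer = count-strict _ U v (λ x → ∧-elimˡ) (¬true⇒false (λ e →
          true≢false (ball-mono {U} {v} {0} {suc r} z≤n (ball-center {U} {v})) (not-elim (∧-elimʳ {U v} e)))) Uv

  -- After isolating `S`, piece numbers are constant along edges, so each component is a single
  -- vertex of `S` or lies inside one piece.
  linear-growth-depth : ∀ G d T → 1 ≤ d → 1 ≤ T →
    (∀ v r → count (Balls.ball (adj G) (Balls.everywhere (adj G)) v r) ≤ suc (2 * r) * T) →
    ∃[ s ] d * s ≤ n G × Depth≤ G (s + pieceBound d T)
  linear-growth-depth G d T 1≤d 1≤T growth =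
    count S , ≤-trans S-small (count≤size {n G} (λ _ → true)) ,
    depth-isolate G S (components-depth (isolate G S) (pieceBound d T) small)
    where
    open Carving (adj G) (adj-sym G) d T 1≤d 1≤T growth
    carved : Carved (λ _ → true) (n G)
    carved = carve (n G) (λ _ → true) (count≤size {n G} (λ _ → true))
    open Carved carved
    same-piece : ∀ {v x} → S v ≡ false → Reach (isolate G S) v x → S x ≡ false × p x ≡ p v
    same-piece sv here = sv , refl
    same-piece sv (step {w} {u} path e) with same-piece sv path | isolate-edge G S w u e
    ... | sw , pw | a , _ , su = su , trans (sym (p-edge w u refl refl sw su a)) pw
    alone : ∀ {v x} → S v ≡ true → Reach (isolate G S) v x → v ≡ x
    alone sv here = refl
    alone {v} sv (step {w} {u} path e) with alone sv path
    ... | refl = ⊥-elim (true≢false sv (proj₁ (proj₂ (isolate-edge G S v u e))))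
    small : ∀ v → ∃[ q ] (∀ x → Reach (isolate G S) v x → q x ≡ true) × count q ≤ pieceBound d T
    small v with S v ≟ᵇ true
    ... | yes sv = (v ≐_) , (λ x path → ≐-intro (alone sv path)) ,
      ≤-trans (≤-reflexive (count-≐ v)) (*-mono-≤ {1} {suc (2 * carveRadius d T)} (s≤s z≤n) 1≤T)
    ... | no ¬sv with p-small v refl (¬true⇒false ¬sv)
    ...   | q , same , q≤ = q , (λ x path → let (sx , px) = same-piece (¬true⇒false ¬sv) path in same x refl sx px) , q≤

  -- Colourings without a splitting vertex

  -- The qualitative part of equitability: which colours occur around a vertex depends only on its
  -- colour. It lets walks be lifted from one vertex to another of the same colour.
  Spread : ∀ {m k} → (Fin m → Fin m → Bool) → (Fin m → Fin k) → Set
  Spread A κ = ∀ x x' y → κ x ≡ κ x' → A x y ≡ true → ∃[ y' ] A x' y' ≡ true × κ y' ≡ κ y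

  -- To be read with `A` the flipped graph, `κ` the current colouring and `κᵥ v` its refinement
  -- after individualizing `v`. The hypothesis `rigid` expresses that no individualization yields
  -- four additional classes.
  module Rigid {m : ℕ} (A : Fin m → Fin m → Bool) (A-sym : ∀ x y → A x y ≡ A y x) (d : ℕ)
    (κ : Fin m → Fin m) (κᵥ : Fin m → Fin m → Fin m)
    (spread : Spread A κ) (spreadᵥ : ∀ v → Spread A (κᵥ v))
    (refinesᵥ : ∀ v → Refines (κᵥ v) κ) (uniqueᵥ : ∀ v → Unique (κᵥ v) v)
    (non-neighbour : ∀ x y → A x y ≡ true → ∃[ u ] κ u ≡ κ y × A x u ≡ false)
    (twin : ∀ x y → A x y ≡ true → ∃[ x' ] κ x' ≡ κ x × x ≢ x')
    (color-degree : ∀ x c → count (λ z → A x z ∧ (κ z ≐ c)) ≤ d)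
    (rigid : ∀ v w₀ w₁ w₂ w₃ → ¬ Removable κ (κᵥ v) (w₀ ∷ w₁ ∷ w₂ ∷ w₃ ∷ []))
    where

    open Balls A

    private
      B : Fin m → ℕ → Fin m → Bool
      B = ball everywhere

      flipped : ∀ {x y} → A x y ≡ true → A y x ≡ true
      flipped {x} {y} a = trans (A-sym y x) a

    adjacent-invariant : ∀ v y u → κᵥ v y ≡ κᵥ v u → A v y ≡ true → A v u ≡ true
    adjacent-invariant v y u e a with spreadᵥ v y u v e (flipped a)
    ... | z , a' , e' rewrite uniqueᵥ v z (sym e') = flipped a'

    -- The class of `v` is a singleton, so by `Spread` the distance from `v` can be read off the
    -- colour under `κᵥ v`.
    ball-invariant : ∀ v r x y → κᵥ v x ≡ κᵥ v y → B v r x ≡ true → B v r y ≡ true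
    ball-invariant v zero x y e b with ≐-elim b
    ... | refl = ≐-intro (uniqueᵥ v y e)
    ball-invariant v (suc r) x y e b with ball-inv {everywhere} {v} r b
    ... | inj₁ b'               = ball-suc {everywhere} {v} r (ball-invariant v r x y e b')
    ... | inj₂ (_ , z , bz , a) with spreadᵥ v x y z e (flipped a)
    ...   | z' , a' , e' = ball-step {everywhere} {v} r (ball-invariant v r z z' (sym e') bz) (flipped a') refl

    -- Individualizing `x` would give four deletable classes: those of `x` and of the three
    -- neighbours. A twin remains in the class of `x`, and a non-neighbour of `x` remains in each
    -- class of a neighbour.
    no-three-colors : ∀ x y₁ y₂ y₃ → A x y₁ ≡ true → A x y₂ ≡ true → A x y₃ ≡ true →
      κ y₁ ≢ κ x → κ y₂ ≢ κ x → κ y₂ ≢ κ y₁ → κ y₃ ≢ κ x → κ y₃ ≢ κ y₁ → κ y₃ ≢ κ y₂ → ⊥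
    no-three-colors x y₁ y₂ y₃ a₁ a₂ a₃ n₁ n₂ n₂₁ n₃ n₃₁ n₃₂
      with twin x y₁ a₁ | non-neighbour x y₁ a₁ | non-neighbour x y₂ a₂ | non-neighbour x y₃ a₃
    ... | x' , ex , x≢x' | u₁ , e₁ , b₁ | u₂ , e₂ , b₂ | u₃ , e₃ , b₃ = rigid x x y₁ y₂ y₃ (record
      { distinct = (lift (n₁ ∘ sym) ∷ lift (n₂ ∘ sym) ∷ lift (n₃ ∘ sym) ∷ []) ∷
                   (lift (n₂₁ ∘ sym) ∷ lift (n₃₁ ∘ sym) ∷ []) ∷ (lift (n₃₂ ∘ sym) ∷ []) ∷ [] ∷ []
      ; mates    = (x' , ex , (λ e → x≢x' (uniqueᵥ x x' (sym e))) ∷ mate ex (n₁ ∘ sym) ∷ mate ex (n₂ ∘ sym) ∷ mate ex (n₃ ∘ sym) ∷ []) ∷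
                   (u₁ , e₁ , mate e₁ n₁ ∷ apart a₁ b₁ ∷ mate e₁ (n₂₁ ∘ sym) ∷ mate e₁ (n₃₁ ∘ sym) ∷ []) ∷
                   (u₂ , e₂ , mate e₂ n₂ ∷ mate e₂ n₂₁ ∷ apart a₂ b₂ ∷ mate e₂ (n₃₂ ∘ sym) ∷ []) ∷
                   (u₃ , e₃ , mate e₃ n₃ ∷ mate e₃ n₃₁ ∷ mate e₃ n₃₂ ∷ apart a₃ b₃ ∷ []) ∷ [] })
      where
      lift : ∀ {y z} → κ y ≢ κ z → κᵥ x y ≢ κᵥ x z
      lift n e = n (refinesᵥ x _ _ e)
      mate : ∀ {u y z} → κ u ≡ κ y → κ y ≢ κ z → κᵥ x u ≢ κᵥ x z
      mate e n e' = n (trans (sym e) (refinesᵥ x _ _ e'))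
      apart : ∀ {y u} → A x y ≡ true → A x u ≡ false → κᵥ x u ≢ κᵥ x y
      apart {y} {u} a b e = true≢false (adjacent-invariant x y u (sym e) a) b

    TwoColors : Fin m → Fin m → Fin m → Set
    TwoColors x a b = ∀ y → A x y ≡ true → κ y ≡ κ x ⊎ κ y ≡ a ⊎ κ y ≡ b

    two-colors : ∀ x → ∃[ a ] ∃[ b ] TwoColors x a b
    two-colors x with any? (λ y → (A x y ≟ᵇ true) ×-dec ¬? (κ y Fin.≟ κ x))
    ... | no none = κ x , κ x , all
      where
      all : TwoColors x (κ x) (κ x)
      all y a with κ y Fin.≟ κ x
      ... | yes e = inj₁ e
      ... | no n  = ⊥-elim (none (y , a , n))
    ... | yes (y₁ , a₁ , n₁) with any? (λ y → (A x y ≟ᵇ true) ×-dec ¬? (κ y Fin.≟ κ x) ×-dec ¬? (κ y Fin.≟ κ y₁))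
    ...   | no none = κ y₁ , κ y₁ , all
      where
      all : TwoColors x (κ y₁) (κ y₁)
      all y a with κ y Fin.≟ κ x | κ y Fin.≟ κ y₁
      ... | yes e | _      = inj₁ e
      ... | _     | yes e₁ = inj₂ (inj₁ e₁)
      ... | no n  | no n'  = ⊥-elim (none (y , a , n , n'))
    ...   | yes (y₂ , a₂ , n₂ , n₂₁) = κ y₁ , κ y₂ , all
      where
      all : TwoColors x (κ y₁) (κ y₂)
      all y a with κ y Fin.≟ κ x | κ y Fin.≟ κ y₁ | κ y Fin.≟ κ y₂
      ... | yes e | _      | _      = inj₁ e
      ... | _     | yes e₁ | _      = inj₂ (inj₁ e₁)
      ... | _     | _      | yes e₂ = inj₂ (inj₂ e₂)
      ... | no n  | no n'  | no n'' = ⊥-elim (no-three-colors x y₁ y₂ y a₁ a₂ a n₁ n₂ n₂₁ n n' n'')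

    degree≤ : ∀ x → count (A x) ≤ 3 * d
    degree≤ x with two-colors x
    ... | a , b , two = count-cover κ (A x) d (κ x ∷ a ∷ b ∷ []) (λ y h → member (two y h)) (color-degree x)
      where
      member : ∀ {y} → κ y ≡ κ x ⊎ κ y ≡ a ⊎ κ y ≡ b → κ y ∈ κ x ∷ a ∷ b ∷ []
      member (inj₁ e)        = here e
      member (inj₂ (inj₁ e)) = there (here e)
      member (inj₂ (inj₂ e)) = there (there (here e))

    ball-size : ∀ v r → count (B v r) ≤ suc (3 * d) ^ r
    ball-size v zero    = ≤-reflexive (count-≐ v)
    ball-size v (suc r) = begin
      count (B v (suc r))                                       ≤⟨ count-∨ (B v r) (λ x → some (λ y → B v r y ∧ A y x)) ⟩
      count (B v r) + count (λ x → some (λ y → B v r y ∧ A y x)) ≤⟨ +-monoʳ-≤ (count (B v r)) neighbours ⟩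
      count (B v r) + count (B v r) * (3 * d)                   ≡⟨ *-suc (count (B v r)) (3 * d) ⟨
      count (B v r) * suc (3 * d)                               ≤⟨ *-monoˡ-≤ (suc (3 * d)) (ball-size v r) ⟩
      suc (3 * d) ^ r * suc (3 * d)                             ≡⟨ *-comm (suc (3 * d) ^ r) (suc (3 * d)) ⟩
      suc (3 * d) ^ suc r                                       ∎
      where
      open ≤-Reasoning
      edge : Fin m → Fin m → Bool
      edge x y = B v r y ∧ A y x
      some≤count : ∀ x → 𝟙 (some (edge x)) ≤ count (edge x)
      some≤count x with some (edge x) in e
      ... | false = z≤n
      ... | true with some-elim (edge x) e
      ...   | y , h = count-positive (edge x) y h
      out-degree : ∀ y → count (λ x → edge x y) ≤ 𝟙 (B v r y) * (3 * d)
      out-degree y with B v r y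
      ... | true  = ≤-trans (degree≤ y) (≤-reflexive (sym (+-identityʳ (3 * d))))
      ... | false = ≤-reflexive (count-zero {m} (λ _ → false) (λ _ → refl))
      neighbours : count (λ x → some (edge x)) ≤ count (B v r) * (3 * d)
      neighbours = begin
        count (λ x → some (edge x))              ≤⟨ sum-mono-≤ some≤count ⟩
        sum (λ x → count (edge x))               ≡⟨ ∑-comm (λ x y → 𝟙 (edge x y)) ⟩
        sum (λ y → count (λ x → edge x y))       ≤⟨ sum-mono-≤ out-degree ⟩
        sum (λ y → 𝟙 (B v r y) * (3 * d))        ≡⟨ *-distribʳ-sum (3 * d) (λ y → 𝟙 (B v r y)) ⟨
        count (B v r) * (3 * d)                  ∎

    -- Follow the path from `u` back towards `v` until it enters the ball of radius `j`; the vertex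
    -- just before lies on the next sphere.
    sphere-nonempty : ∀ v j s u → B v s u ≡ true → B v j u ≡ false → ∃[ w ] B v (suc j) w ≡ true × B v j w ≡ false
    sphere-nonempty v j zero u b ¬b = ⊥-elim (true≢false (ball-mono {everywhere} {v} {0} {j} z≤n b) ¬b)
    sphere-nonempty v j (suc s) u b ¬b with ball-inv {everywhere} {v} s b
    ... | inj₁ b'               = sphere-nonempty v j s u b' ¬b
    ... | inj₂ (_ , y , by , a) with B v j y ≟ᵇ true
    ...   | yes by' = u , ball-step {everywhere} {v} j by' a refl , ¬b
    ...   | no ¬by  = sphere-nonempty v j s y by (¬true⇒false ¬by)

    sphere-pred : ∀ v r w → B v (2 + r) w ≡ true → B v (suc r) w ≡ false → ∃[ y ] A y w ≡ true × B v (suc r) y ≡ true × B v r y ≡ false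
    sphere-pred v r w b ¬b with ball-inv {everywhere} {v} (suc r) b
    ... | inj₁ b'               = ⊥-elim (true≢false b' ¬b)
    ... | inj₂ (_ , y , by , a) = y , a , by , ¬true⇒false (λ by' → true≢false (ball-step {everywhere} {v} r by' a refl) ¬b)

    retreat : ∀ v r {x y} → A x y ≡ true → B v (suc r) x ≡ false → B v r y ≡ false
    retreat v r a ¬b = ¬true⇒false (λ b → true≢false (ball-step {everywhere} {v} r b (flipped a) refl) ¬b)

    -- Otherwise lift the start w₀ w₁ w₂ w₃ of a shortest path from v to u₀ to a walk u₀ u₁ u₂ u₃ with the same colours:
    -- the uᵢ stay outside the ball of radius 3 around v, so individualizing v would create four new classes.
    same-color-near : ∀ v u₀ s → κ u₀ ≡ κ v → B v s u₀ ≡ true → B v 6 u₀ ≡ true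
    same-color-near v u₀ s e₀ reach with B v 6 u₀ ≟ᵇ true
    ... | yes near = near
    ... | no ¬near = ⊥-elim (impossible (¬true⇒false ¬near))
      where
      weaken : ∀ r t {x} → r ≤ t → B v t x ≡ false → B v r x ≡ false
      weaken r t r≤t ¬b = ¬true⇒false (λ b → true≢false (ball-mono {everywhere} {v} {r} {t} r≤t b) ¬b)
      apart : ∀ r {x y} → B v r x ≡ true → B v r y ≡ false → κᵥ v x ≢ κᵥ v y
      apart r {x} {y} bx ¬by e = true≢false (ball-invariant v r x y e bx) ¬by
      impossible : B v 6 u₀ ≡ false → ⊥
      impossible far₀ with sphere-nonempty v 2 s u₀ reach (weaken 2 6 (s≤s (s≤s z≤n)) far₀)
      ... | w₃ , in₃ , out₃ with sphere-pred v 1 w₃ in₃ out₃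
      ... | w₂ , a₂₃ , in₂ , out₂ with sphere-pred v 0 w₂ in₂ out₂
      ... | w₁ , a₁₂ , in₁ , out₁ with ball-inv {everywhere} {v} 0 in₁
      ... | inj₁ b = true≢false b out₁
      ... | inj₂ (_ , w₀ , b₀ , a₀₁) with ≐-elim b₀
      ... | refl with spread v u₀ w₁ (sym e₀) a₀₁
      ... | u₁ , c₀₁ , e₁ with spread w₁ u₁ w₂ (sym e₁) a₁₂
      ... | u₂ , c₁₂ , e₂ with spread w₂ u₂ w₃ (sym e₂) a₂₃
      ... | u₃ , c₂₃ , e₃ = rigid v v w₁ w₂ w₃ (record
        { distinct = (apart 0 b₀ out₁ ∷ apart 0 b₀ (weaken 0 1 z≤n out₂) ∷ apart 0 b₀ (weaken 0 2 z≤n out₃) ∷ []) ∷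
                     (apart 1 in₁ out₂ ∷ apart 1 in₁ (weaken 1 2 (s≤s z≤n) out₃) ∷ []) ∷ (apart 2 in₂ out₃ ∷ []) ∷ [] ∷ []
        ; mates    = (u₀ , e₀ , beyond (weaken 3 6 3≤6 far₀)) ∷ (u₁ , e₁ , beyond (weaken 3 5 3≤5 far₁)) ∷
                     (u₂ , e₂ , beyond (weaken 3 4 3≤4 far₂)) ∷ (u₃ , e₃ , beyond far₃) ∷ [] })
        where
        3≤4 : 3 ≤ 4
        3≤4 = s≤s (s≤s (s≤s z≤n))
        3≤5 : 3 ≤ 5
        3≤5 = s≤s (s≤s (s≤s z≤n))
        3≤6 : 3 ≤ 6
        3≤6 = s≤s (s≤s (s≤s z≤n))
        -- Each step of the lifted walk approaches `v` by at most one, so starting beyond radius 6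
        -- leaves its fourth vertex beyond radius 3, which contains all of the original path. Hence
        -- 6 = 3 + 3.
        far₁ = retreat v 5 c₀₁ far₀
        far₂ = retreat v 4 c₁₂ far₁
        far₃ = retreat v 3 c₂₃ far₂
        beyond : ∀ {u} → B v 3 u ≡ false → All (λ w → κᵥ v u ≢ κᵥ v w) (v ∷ w₁ ∷ w₂ ∷ w₃ ∷ [])
        beyond ¬b = (apart 3 (ball-mono {everywhere} {v} {0} {3} z≤n b₀) ¬b ∘ sym) ∷
                    (apart 3 (ball-mono {everywhere} {v} {1} {3} (s≤s z≤n) in₁) ¬b ∘ sym) ∷
                    (apart 3 (ball-mono {everywhere} {v} {2} {3} (s≤s (s≤s z≤n)) in₂) ¬b ∘ sym) ∷
                    (apart 3 in₃ ¬b ∘ sym) ∷ []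

    -- Two vertices of one colour in the ball are joined through `v` by a walk of length `r + r`, so
    -- `same-color-near` puts them within distance 6 of each other. The bound is therefore
    -- independent of `r`.
    color-in-ball : ∀ v r c → count (λ x → B v r x ∧ (κ x ≐ c)) ≤ suc (3 * d) ^ 6
    color-in-ball v r c with any? (λ x → (B v r x ∧ (κ x ≐ c)) ≟ᵇ true)
    ... | no none    = ≤-trans (≤-reflexive (count-zero _ (λ x → ¬true⇒false (λ h → none (x , h))))) z≤n
    ... | yes (x , h) = ≤-trans (count-mono {q = B x 6} near) (ball-size x 6)
      where
      near : ∀ y → B v r y ∧ (κ y ≐ c) ≡ true → B x 6 y ≡ true
      near y h' = same-color-near x y (r + r) (trans (≐-elim (∧-elimʳ {B v r y} h')) (sym (≐-elim (∧-elimʳ {B v r x} h))))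
        (ball-trans r r (ball-sym A-sym r (∧-elimˡ h)) (∧-elimˡ h'))

    -- A set of colours closed under adjacency except for at most two outgoing colours: the colours form paths and cycles.
    record Segment (v : Fin m) (r : ℕ) : Set where
      field
        cs      : List (Fin m)
        a b     : Fin m
        size    : length cs ≡ suc (2 * r)
        center  : κ v ∈ cs
        covers  : ∀ x → B v r x ≡ true → κ x ∈ cs
        leaving : ∀ x y → κ x ∈ cs → A x y ≡ true → κ y ∈ cs ⊎ κ y ≡ a ⊎ κ y ≡ b

    module _ (v : Fin m) (cs : List (Fin m)) (center : κ v ∈ cs) where

      -- a is the next colour in some direction; it is replaced by the colour of v when it is not adjacent to cs.
      record Next (a : Fin m) : Set where
        field
          a₁ a₂  : Fin m
          enters : ∀ x z → κ x ≡ a → A x z ≡ true → κ z ∈ cs → κ x ∈ cs ⊎ κ x ≡ a₁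
          leaves : ∀ x y → κ x ≡ a₁ → A x y ≡ true → κ x ∈ cs ⊎ κ y ∈ cs ⊎ κ y ≡ a₁ ⊎ κ y ≡ a₂

      -- If `a` is a new colour adjacent to `cs`, one of its at most two foreign neighbour colours
      -- is already in `cs`, so at most one colour leads onward.
      next : ∀ a → Next a
      next a with mem? Fin._≟_ a cs
      ... | yes a∈ = record { a₁ = a ; a₂ = a ; enters = λ _ _ e _ _ → inj₂ e ; leaves = λ { _ _ refl _ → inj₁ a∈ } }
      ... | no a∉ with any? (λ x → (κ x Fin.≟ a) ×-dec any? (λ z → (A x z ≟ᵇ true) ×-dec mem? Fin._≟_ (κ z) cs))
      ...   | no none = record { a₁ = κ v ; a₂ = κ v ; enters = λ x z e h z∈ → ⊥-elim (none (x , e , z , h , z∈))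
                               ; leaves = λ x y e _ → inj₁ (subst (_∈ cs) (sym e) center) }
      ...   | yes (x , refl , z , h , z∈) with two-colors x
      ...     | α , β , two = record { a₁ = κ x ; a₂ = proj₁ onward ; enters = λ _ _ e _ _ → inj₂ e
                                     ; leaves = λ x' y e h' → inj₂ (leave x' y e h') }
        where
        onward : ∃[ γ ] ∀ y → A x y ≡ true → κ y ∈ cs ⊎ κ y ≡ κ x ⊎ κ y ≡ γ
        onward with two z h
        -- The neighbour `z` has a colour in `cs`, whereas the colour `a` of `x` has none, so `z`
        -- accounts for one of the two foreign colours of `x`.
        ... | inj₁ e = ⊥-elim (a∉ (subst (_∈ cs) e z∈))
        ... | inj₂ (inj₁ e) = β , λ y h' → case (two y h')
          where
          case : ∀ {y} → κ y ≡ κ x ⊎ κ y ≡ α ⊎ κ y ≡ β → κ y ∈ cs ⊎ κ y ≡ κ x ⊎ κ y ≡ β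
          case (inj₁ e')        = inj₂ (inj₁ e')
          case (inj₂ (inj₁ e')) = inj₁ (subst (_∈ cs) (trans e (sym e')) z∈)
          case (inj₂ (inj₂ e')) = inj₂ (inj₂ e')
        ... | inj₂ (inj₂ e) = α , λ y h' → case (two y h')
          where
          case : ∀ {y} → κ y ≡ κ x ⊎ κ y ≡ α ⊎ κ y ≡ β → κ y ∈ cs ⊎ κ y ≡ κ x ⊎ κ y ≡ α
          case (inj₁ e')        = inj₂ (inj₁ e')
          case (inj₂ (inj₁ e')) = inj₂ (inj₂ e')
          case (inj₂ (inj₂ e')) = inj₁ (subst (_∈ cs) (trans e (sym e')) z∈)
        leave : ∀ x' y → κ x' ≡ κ x → A x' y ≡ true → κ y ∈ cs ⊎ κ y ≡ κ x ⊎ κ y ≡ proj₁ onward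
        leave x' y e h' with spread x' x y e h'
        ... | y' , h'' , e' rewrite sym e' = proj₂ onward y' h''

    -- Each unit of radius extends the segment by one colour at either end. Colours may repeat in
    -- the list, which is why its length is exact even when a path ends or a cycle closes.
    segment : ∀ v r → Segment v r
    segment v zero with two-colors v
    ... | a , b , two = record
      { cs = κ v ∷ [] ; a = a ; b = b ; size = refl ; center = here refl
      ; covers = λ x h → here (cong κ (sym (≐-elim h))) ; leaving = leaving }
      where
      leaving : ∀ x y → κ x ∈ κ v ∷ [] → A x y ≡ true → κ y ∈ κ v ∷ [] ⊎ κ y ≡ a ⊎ κ y ≡ b
      leaving x y (here e) h with spread x v y e h
      ... | y' , h' , e' with two y' h'
      ...   | inj₁ e'' = inj₁ (here (trans (sym e') e''))
      ...   | inj₂ (inj₁ e'') = inj₂ (inj₁ (trans (sym e') e''))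
      ...   | inj₂ (inj₂ e'') = inj₂ (inj₂ (trans (sym e') e''))
    segment v (suc r) = record
      { cs = cs' ; a = N.a₂ ; b = N'.a₂ ; size = trans (cong (2 +_) size) (cong suc (sym (*-suc 2 r)))
      ; center = there (there center) ; covers = covers' ; leaving = leaving' }
      where
      open Segment (segment v r)
      module N = Next (next v cs center a)
      module N' = Next (next v cs center b)
      cs' = N.a₁ ∷ N'.a₁ ∷ cs
      absorbed : ∀ x z → κ z ∈ cs → A z x ≡ true → κ x ∈ cs'
      absorbed x z z∈ h with leaving z x z∈ h
      ... | inj₁ x∈ = there (there x∈)
      ... | inj₂ (inj₁ e) with N.enters x z e (flipped h) z∈
      ...   | inj₁ x∈ = there (there x∈)
      ...   | inj₂ e' = here e'
      absorbed x z z∈ h | inj₂ (inj₂ e) with N'.enters x z e (flipped h) z∈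
      ...   | inj₁ x∈ = there (there x∈)
      ...   | inj₂ e' = there (here e')
      covers' : ∀ x → B v (suc r) x ≡ true → κ x ∈ cs'
      covers' x h with ball-inv {everywhere} {v} r h
      ... | inj₁ b              = there (there (covers x b))
      ... | inj₂ (_ , z , bz , a) = absorbed x z (covers z bz) a
      leaving' : ∀ x y → κ x ∈ cs' → A x y ≡ true → κ y ∈ cs' ⊎ κ y ≡ N.a₂ ⊎ κ y ≡ N'.a₂
      leaving' x y (there (there x∈)) h = inj₁ (absorbed y x x∈ h)
      leaving' x y (here e) h with N.leaves x y e h
      ... | inj₁ x∈               = inj₁ (absorbed y x x∈ h)
      ... | inj₂ (inj₁ y∈)        = inj₁ (there (there y∈))
      ... | inj₂ (inj₂ (inj₁ e')) = inj₁ (here e')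
      ... | inj₂ (inj₂ (inj₂ e')) = inj₂ (inj₁ e')
      leaving' x y (there (here e)) h with N'.leaves x y e h
      ... | inj₁ x∈               = inj₁ (absorbed y x x∈ h)
      ... | inj₂ (inj₁ y∈)        = inj₁ (there (there y∈))
      ... | inj₂ (inj₂ (inj₁ e')) = inj₁ (there (here e'))
      ... | inj₂ (inj₂ (inj₂ e')) = inj₂ (inj₂ e')

    linear-growth : ∀ v r → count (B v r) ≤ suc (2 * r) * suc (3 * d) ^ 6
    linear-growth v r = ≤-trans (count-cover κ (B v r) (suc (3 * d) ^ 6) cs covers (color-in-ball v r))
      (≤-reflexive (cong (_* suc (3 * d) ^ 6) size))
      where open Segment (segment v r)

  -- Flipping by density

  -- Flip functions act on all natural numbers, while densities are known only for colours below
  -- `m`; all other pairs are left unflipped.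
  onColors : ∀ {m} → (Fin m → Fin m → Bool) → ℕ → ℕ → Bool
  onColors {m} F a b with a <? m | b <? m
  ... | yes p | yes q = F (fromℕ< p) (fromℕ< q)
  ... | _     | _     = false

  onColors-sym : ∀ {m} (F : Fin m → Fin m → Bool) → (∀ i j → F i j ≡ F j i) → ∀ a b → onColors F a b ≡ onColors F b a
  onColors-sym {m} F F-sym a b with a <? m | b <? m
  ... | yes p | yes q = F-sym _ _
  ... | yes _ | no _  = refl
  ... | no _  | yes _ = refl
  ... | no _  | no _  = refl

  onColors-toℕ : ∀ {m} (F : Fin m → Fin m → Bool) i j → onColors F (toℕ i) (toℕ j) ≡ F i j
  onColors-toℕ {m} F i j with toℕ i <? m | toℕ j <? m
  ... | yes p | yes q = cong₂ F (fromℕ<-toℕ i p) (fromℕ<-toℕ j q)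
  ... | no ¬p | _     = contradiction (toℕ<n i) ¬p
  ... | yes _ | no ¬q = contradiction (toℕ<n j) ¬q

  module Flip (G : ColGraph) (F : Fin (n G) → Fin (n G) → Bool) (F-sym : ∀ i j → F i j ≡ F j i)
    (κ : Fin (n G) → Fin (n G)) where

    flippedGraph : ColGraph
    flippedGraph = flipG (recolor G (toℕ ∘ κ)) (onColors F) (onColors-sym F F-sym)

    private
      A : Fin (n G) → Fin (n G) → Bool
      A = adj G
      A' : Fin (n G) → Fin (n G) → Bool
      A' = adj flippedGraph

    flipped-distinct : ∀ {x y} → x ≢ y → A' x y ≡ A x y xor F (κ x) (κ y)
    flipped-distinct {x} {y} x≢y with x Fin.≟ y
    ... | yes x≡y = contradiction x≡y x≢y
    ... | no _    = cong (A x y xor_) (onColors-toℕ F (κ x) (κ y))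

    unflipped : ∀ {x y} → F (κ x) (κ y) ≡ false → A' x y ≡ A x y
    unflipped {x} {y} f with x Fin.≟ y
    ... | yes refl = sym (adj-irr G x)
    ... | no _ rewrite onColors-toℕ F (κ x) (κ y) | f with A x y
    ...   | true  = refl
    ...   | false = refl

    flipped-off : ∀ {x y} → F (κ x) (κ y) ≡ true → A' x y ≡ true → A x y ≡ false × x ≢ y
    flipped-off {x} {y} f a with x Fin.≟ y
    ... | no x≢y rewrite onColors-toℕ F (κ x) (κ y) | f with A x y
    ...   | false = refl , x≢y

    flipped-on : ∀ {x y} → F (κ x) (κ y) ≡ true → A x y ≡ false → x ≢ y → A' x y ≡ true
    flipped-on {x} {y} f a x≢y = trans (flipped-distinct x≢y) (cong₂ _xor_ a f)

    -- Whether a pair is flipped depends on `κ`, hence on `ρ`. For an unflipped pair the neighbour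
    -- counts agree. For a flipped pair a new neighbour is a vertex of the class outside the closed
    -- neighbourhood, and closed neighbourhoods of equally coloured vertices meet the class in
    -- equally many vertices.
    spread-flipped : ∀ {k} (ρ : Fin (n G) → Fin k) → Refines ρ κ → Equitable A ρ → Spread A' ρ
    spread-flipped ρ fine eq x x' y e a with F (κ x) (κ y) in f
    ... | false = transfer (count-∃ (neighbour x')
                    (≤-trans (count-positive (neighbour x) y (∧-intro (trans (sym (unflipped f)) a) (≐-refl (ρ y))))
                      (≤-reflexive (eq x x' e (ρ y)))))
      where
      neighbour : Fin (n G) → Fin (n G) → Bool
      neighbour x z = A x z ∧ (ρ z ≐ ρ y)
      transfer : ∃[ y' ] neighbour x' y' ≡ true → ∃[ y' ] A' x' y' ≡ true × ρ y' ≡ ρ y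
      transfer (y' , h) = y' , trans (unflipped f') (∧-elimˡ h) , ≐-elim (∧-elimʳ {A x' y'} h)
        where
        f' : F (κ x') (κ y') ≡ false
        f' = trans (cong₂ F (sym (fine x x' e)) (fine y' y (≐-elim (∧-elimʳ {A x' y'} h)))) f
    ... | true = transfer (count<⇒∃ (closed x') (λ z → ρ z ≐ ρ y) (≤-<-trans (≤-reflexive (sym closed-size)) smaller))
      where
      closed : Fin (n G) → Fin (n G) → Bool
      -- The vertex `x` itself is included when it lies in the class of `y`, because flips create no
      -- loops.
      closed x z = (A x z ∧ (ρ z ≐ ρ y)) ∨ ((ρ x ≐ ρ y) ∧ (x ≐ z))
      loop : ∀ x → count (λ z → (ρ x ≐ ρ y) ∧ (x ≐ z)) ≡ 𝟙 (ρ x ≐ ρ y)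
      loop x with ρ x ≐ ρ y
      ... | true  = count-≐ x
      ... | false = count-zero {n G} (λ _ → false) (λ _ → refl)
      closed-count : ∀ x → count (closed x) ≡ count (λ z → A x z ∧ (ρ z ≐ ρ y)) + 𝟙 (ρ x ≐ ρ y)
      closed-count x = trans (≤-antisym (count-∨ _ (λ z → (ρ x ≐ ρ y) ∧ (x ≐ z)))
          (count-disjoint _ (λ z → (ρ x ≐ ρ y) ∧ (x ≐ z)) (closed x) (λ z → ∨-introˡ) (λ z → ∨-introʳ {A x z ∧ (ρ z ≐ ρ y)}) irreflexive))
        (cong (count (λ z → A x z ∧ (ρ z ≐ ρ y)) +_) (loop x))
        where
        irreflexive : ∀ z → A x z ∧ (ρ z ≐ ρ y) ≡ true → (ρ x ≐ ρ y) ∧ (x ≐ z) ≡ true → ⊥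
        irreflexive z p q with ≐-elim {x = x} (∧-elimʳ {ρ x ≐ ρ y} q)
        ... | refl = true≢false (∧-elimˡ p) (adj-irr G x)
      closed-size : count (closed x) ≡ count (closed x')
      closed-size = trans (closed-count x) (trans (cong₂ (λ a b → a + 𝟙 (b ≐ ρ y)) (eq x x' e (ρ y)) e) (sym (closed-count x')))
      in-class : ∀ x z → closed x z ≡ true → (ρ z ≐ ρ y) ≡ true
      in-class x z h with ∨-elim {A x z ∧ (ρ z ≐ ρ y)} h
      ... | inj₁ p = ∧-elimʳ {A x z} p
      ... | inj₂ q with ≐-elim {x = x} (∧-elimʳ {ρ x ≐ ρ y} q)
      ...   | refl = ∧-elimˡ q
      smaller : count (closed x) < count (λ z → ρ z ≐ ρ y)
      smaller = count-strict (closed x) (λ z → ρ z ≐ ρ y) y (in-class x) (¬true⇒false (λ h → case (∨-elim {A x y ∧ (ρ y ≐ ρ y)} h))) (≐-refl (ρ y))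
        where
        case : A x y ∧ (ρ y ≐ ρ y) ≡ true ⊎ (ρ x ≐ ρ y) ∧ (x ≐ y) ≡ true → ⊥
        case (inj₁ p) = true≢false (∧-elimˡ p) (proj₁ (flipped-off f a))
        case (inj₂ q) = proj₂ (flipped-off f a) (≐-elim (∧-elimʳ {ρ x ≐ ρ y} q))
      transfer : ∃[ y' ] (ρ y' ≐ ρ y) ≡ true × closed x' y' ≡ false → ∃[ y' ] A' x' y' ≡ true × ρ y' ≡ ρ y
      transfer (y' , c , ¬h) = y' , flipped-on f' a' x'≢y' , ≐-elim c
        where
        f' : F (κ x') (κ y') ≡ true
        f' = trans (cong₂ F (sym (fine x x' e)) (fine y' y (≐-elim c))) f
        a' : A x' y' ≡ false
        a' = ¬true⇒false (λ a → true≢false (∨-introˡ (∧-intro a c)) ¬h)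
        x'≢y' : x' ≢ y'
        x'≢y' refl = true≢false (∨-introʳ {A x' y' ∧ (ρ y' ≐ ρ y)} (∧-intro c (≐-refl x'))) ¬h

  -- Degrees after flipping the dense pairs

  module Density (G : ColGraph) (κ : Fin (n G) → Fin (n G)) (equitable : Equitable (adj G) κ) where

    private
      A : Fin (n G) → Fin (n G) → Bool
      A = adj G

    classSize : Fin (n G) → ℕ
    classSize c = count (λ x → κ x ≐ c)

    degree : Fin (n G) → Fin (n G) → ℕ
    degree x c = count (λ z → A x z ∧ (κ z ≐ c))

    edges : Fin (n G) → Fin (n G) → ℕ
    edges c c' = sum (λ x → count (λ y → (κ x ≐ c) ∧ (A x y ∧ (κ y ≐ c'))))

    edges-sym : ∀ c c' → edges c c' ≡ edges c' c
    edges-sym c c' = trans (∑-comm (λ x y → 𝟙 ((κ x ≐ c) ∧ (A x y ∧ (κ y ≐ c')))))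
      (sum-cong-≗ (λ y → count-cong (λ x → reorder x y)))
      where
      reorder : ∀ x y → ((κ x ≐ c) ∧ (A x y ∧ (κ y ≐ c'))) ≡ ((κ y ≐ c') ∧ (A y x ∧ (κ x ≐ c)))
      reorder x y rewrite adj-sym G x y with κ x ≐ c | A y x | κ y ≐ c'
      ... | true  | true  | true  = refl
      ... | true  | true  | false = refl
      ... | true  | false | true  = refl
      ... | true  | false | false = refl
      ... | false | true  | true  = refl
      ... | false | true  | false = refl
      ... | false | false | true  = refl
      ... | false | false | false = refl

    edges-degree : ∀ x c → edges (κ x) c ≡ classSize (κ x) * degree x c
    edges-degree x c = trans (sum-cong-≗ row) (sym (*-distribʳ-sum (degree x c) (λ x' → 𝟙 (κ x' ≐ κ x))))
      where
      row : ∀ x' → count (λ y → (κ x' ≐ κ x) ∧ (A x' y ∧ (κ y ≐ c))) ≡ 𝟙 (κ x' ≐ κ x) * degree x c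
      row x' with κ x' ≐ κ x in e
      ... | true  = trans (equitable x' x (≐-elim e) c) (sym (+-identityʳ (degree x c)))
      ... | false = count-zero {n G} (λ _ → false) (λ _ → refl)

    abstract
      -- Density is measured by the number of edges between the classes, which makes it symmetric as
      -- a flip function must be. By equitability it is equivalent to every vertex of one class
      -- being adjacent to more than half of the other.
      dense : Fin (n G) → Fin (n G) → Bool
      dense c c' = does (classSize c * classSize c' <? 2 * edges c c')

      dense-sym : ∀ c c' → dense c c' ≡ dense c' c
      dense-sym c c' = cong₂ (λ a b → does (a <? 2 * b)) (*-comm (classSize c) (classSize c')) (edges-sym c c')

      private
        twice : ∀ x c → 2 * edges (κ x) c ≡ classSize (κ x) * (2 * degree x c)
        twice x c = trans (cong (2 *_) (edges-degree x c))
          (solve 2 (λ s t → con 2 :* (s :* t) := s :* (con 2 :* t)) refl (classSize (κ x)) (degree x c))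
          where open +-*-Solver

      dense⇒ : ∀ x c → dense (κ x) c ≡ true → classSize c < 2 * degree x c
      dense⇒ x c h = *-cancelˡ-< (classSize (κ x)) _ _
        (subst (classSize (κ x) * classSize c <_) (twice x c) (does-elim (_ <? _) h))

      sparse⇒ : ∀ x c → dense (κ x) c ≡ false → 2 * degree x c ≤ classSize c
      sparse⇒ x c h = *-cancelˡ-≤ (classSize (κ x)) {{>-nonZero (count-positive (λ y → κ y ≐ κ x) x (≐-refl (κ x)))}}
        (subst (_≤ classSize (κ x) * classSize c) (twice x c)
          (≮⇒≥ (λ lt → true≢false (dec-true (classSize (κ x) * classSize c <? 2 * edges (κ x) c) lt) h)))

    open Flip G dense dense-sym κ public

    private
      A' : Fin (n G) → Fin (n G) → Bool
      A' = adj flippedGraph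

    codegree : Fin (n G) → Fin (n G) → ℕ
    codegree x c = count (λ z → (κ z ≐ c) ∧ not (A x z))

    degree+codegree : ∀ x c → classSize c ≡ degree x c + codegree x c
    degree+codegree x c = trans (count-split (λ z → κ z ≐ c) (A x)) (cong (_+ codegree x c) (count-cong (λ z → ∧-comm (κ z ≐ c) (A x z))))

    flippedDegree : Fin (n G) → Fin (n G) → ℕ
    flippedDegree x c = count (λ z → A' x z ∧ (κ z ≐ c))

    -- The flip is made exactly when the non-neighbours are fewer, so what remains is bounded by the
    -- smaller of the two counts. A vertex counts as a non-neighbour of itself here.
    flippedDegree-min : ∀ x c → flippedDegree x c ≤ degree x c × flippedDegree x c ≤ codegree x c
    flippedDegree-min x c with dense (κ x) c in f
    ... | false = small , ≤-trans small (+-cancelˡ-≤ (degree x c) _ _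
                    (subst₂ _≤_ (cong (degree x c +_) (+-identityʳ (degree x c))) (degree+codegree x c) (sparse⇒ x c f)))
      where
      small : flippedDegree x c ≤ degree x c
      small = count-mono (λ z h → ∧-intro (trans (sym (unflipped (trans (cong (dense (κ x)) (≐-elim (∧-elimʳ {A' x z} h))) f))) (∧-elimˡ h))
                                          (∧-elimʳ {A' x z} h))
    ... | true  = ≤-trans small (<⇒≤ (+-cancelˡ-< (degree x c) _ _
                    (subst₂ _<_ (degree+codegree x c) (cong (degree x c +_) (+-identityʳ (degree x c))) (dense⇒ x c f)))) , small
      where
      small : flippedDegree x c ≤ codegree x c
      small = count-mono (λ z h → ∧-intro (∧-elimʳ {A' x z} h)
        (not-intro (proj₁ (flipped-off (trans (cong (dense (κ x)) (≐-elim (∧-elimʳ {A' x z} h))) f) (∧-elimˡ h)))))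

    -- A vertex with a neighbour in a class thus misses at least as many vertices there. This yields
    -- the non-neighbours and twins that serve as mates in `Rigid`.
    flippedDegree-half : ∀ x c → flippedDegree x c + flippedDegree x c ≤ classSize c
    flippedDegree-half x c with flippedDegree-min x c
    ... | p , q = ≤-trans (+-mono-≤ p q) (≤-reflexive (sym (degree+codegree x c)))

    private
      flippedDegree-positive : ∀ x y → A' x y ≡ true → 1 ≤ flippedDegree x (κ y)
      flippedDegree-positive x y a = count-positive (λ z → A' x z ∧ (κ z ≐ κ y)) y (∧-intro a (≐-refl (κ y)))

    flipped-non-neighbour : ∀ x y → A' x y ≡ true → ∃[ u ] κ u ≡ κ y × A' x u ≡ false
    flipped-non-neighbour x y a with count<⇒∃ (λ z → A' x z ∧ (κ z ≐ κ y)) (λ z → κ z ≐ κ y)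
      (<-≤-trans (m<m+n (flippedDegree x (κ y)) (flippedDegree-positive x y a)) (flippedDegree-half x (κ y)))
    ... | u , e , h = u , ≐-elim e , ¬true⇒false (λ a' → true≢false (∧-intro a' e) h)

    flipped-twin : ∀ x y → A' x y ≡ true → ∃[ x' ] κ x' ≡ κ x × x ≢ x'
    flipped-twin x y a with count<⇒∃ (x ≐_) (λ z → κ z ≐ κ x)
      (≤-trans (≤-reflexive (cong suc (count-≐ x))) (≤-trans (+-mono-≤ positive positive) (flippedDegree-half y (κ x))))
      where
      positive : 1 ≤ flippedDegree y (κ x)
      positive = flippedDegree-positive y x (trans (adj-sym flippedGraph y x) a)
    ... | x' , e , h = x' , ≐-elim e , λ x≡x' → true≢false (≐-intro x≡x') h

  -- The recursion

  fiberBound : ℕ → ℕ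
  fiberBound d = suc (3 * d) ^ 6

  residue : ℕ → ℕ
  residue d = pieceBound d (fiberBound d)

  module Refining (G : ColGraph) (d : ℕ) (1≤d : 1 ≤ d) where

    private
      Coloring : Set
      Coloring = Fin (n G) → Fin (n G)

      colored : Coloring → ColGraph
      colored κ = recolor G (toℕ ∘ κ)

    afterIndividualizing : Coloring → Fin (n G) → Coloring
    afterIndividualizing κ v = Refinement.κ (refine (individualize (colored κ) v))

    module _ (κ : Coloring) (v : Fin (n G)) where

      private
        open module R = Refinement (refine (individualize (colored κ) v)) using (refines)
        κᵥ : Coloring
        κᵥ = afterIndividualizing κ v

      after-equitable : Equitable (adj G) κᵥ
      after-equitable = R.equitable

      after-refines : Refines κᵥ κ
      after-refines x y e = toℕ-injective (individualize-refines (colored κ) v x y (refines x y e))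

      after-unique : Unique κᵥ v
      after-unique y e = individualize-unique (colored κ) v y (refines v y e)

      after-adjacent : ∀ x y → κᵥ x ≡ κᵥ y → adj G v x ≡ adj G v y
      after-adjacent x y e = trans (adj-sym G v x)
        (trans (equitable-at-unique (adj G) κᵥ after-equitable after-unique x y e) (adj-sym G y v))

      depth-after : ∀ {k} → Depth≤ (colored κᵥ) k → Depth≤ (colored κ) (suc k)
      depth-after t = depth-individualize v (depth-refine {individualize (colored κ) v} t)

      after-numClasses : numClasses κ ≤ numClasses κᵥ
      after-numClasses = ≤-trans (≤-reflexive (sym (+-identityʳ _)))
        (numClasses-grows κ κᵥ [] after-refines (record { distinct = [] ; mates = [] }))

      after-excess : excess d κᵥ ≤ excess d κ
      after-excess = excess-mono d κ κᵥ after-refines (λ _ → true) (λ _ _ _ → refl)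

    -- One free flip makes both impossibilities usable: the failed drop bounds the degree into each
    -- class, and the failed growth is the rigidity hypothesis.
    terminal : ∀ κ → Equitable (adj G) κ →
      (∀ v → ¬ (numClasses κ + 4 ≤ numClasses (afterIndividualizing κ v))) →
      (∀ v → ¬ (excess d (afterIndividualizing κ v) + d ≤ excess d κ)) →
      ∃[ s ] d * s ≤ n G × Depth≤ (colored κ) (s + residue d)
    terminal κ equitable no-growth no-drop =
      s , s≤ , (d2 _ _ (proj₁ tree) , proj₂ tree)
      where
      open Density G κ equitable
      κᵥ : Fin (n G) → Coloring
      κᵥ = afterIndividualizing κ
      color-degree : ∀ x c → flippedDegree x c ≤ d
      -- More than `d` flipped neighbours in `c` would mean at least `d` neighbours and at least `d`
      -- non-neighbours of `x` there, so individualizing `x` would split `c` into two large parts.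
      color-degree x c = ≮⇒≥ λ d< → no-drop x (excess-drop d κ (κᵥ x) (after-refines κ x) (adj G x) (after-adjacent κ x) c
        (≤-trans (<⇒≤ d<) (≤-trans (proj₁ (flippedDegree-min x c)) (≤-reflexive (count-cong (λ z → ∧-comm (adj G x z) (κ z ≐ c))))))
        (≤-trans (<⇒≤ d<) (proj₂ (flippedDegree-min x c))))
      open Rigid (adj flippedGraph) (adj-sym flippedGraph) d κ κᵥ
        (spread-flipped κ (λ _ _ e → e) equitable)
        (λ v → spread-flipped (κᵥ v) (after-refines κ v) (after-equitable κ v))
        (after-refines κ) (after-unique κ) flipped-non-neighbour flipped-twin color-degree
        (λ v w₀ w₁ w₂ w₃ removable → no-growth v (numClasses-grows κ (κᵥ v) _ (after-refines κ v) removable))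
      finish = linear-growth-depth flippedGraph d (fiberBound d) 1≤d (m^n>0 (suc (3 * d)) 6) linear-growth
      s = proj₁ finish
      s≤ = proj₁ (proj₂ finish)
      tree = proj₂ (proj₂ finish)

    -- `a` and `b` count the individualizations still to come that pay by class growth and by
    -- excess. Both inequalities are relative to the potentials of `κ`, so a step put in front is
    -- paid by one potential while the other is monotone.
    record Budget (κ : Coloring) : Set where
      field
        a b s    : ℕ
        growth   : 4 * a + numClasses κ ≤ n G
        drop     : d * b ≤ excess d κ
        isolated : d * s ≤ n G
        depth    : Depth≤ (colored κ) (a + b + (s + residue d))

    budget-growth : ∀ κ v → numClasses κ + 4 ≤ numClasses (afterIndividualizing κ v) → Budget (afterIndividualizing κ v) → Budget κ
    budget-growth κ v grows rest = record
      { a = suc a ; b = b ; s = s ; isolated = isolated ; depth = depth-after κ v depth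
      ; growth = ≤-trans (≤-reflexive (solve 2 (λ a N → con 4 :* (con 1 :+ a) :+ N := con 4 :* a :+ (N :+ con 4)) refl a (numClasses κ)))
                   (≤-trans (+-monoʳ-≤ (4 * a) grows) growth)
      ; drop = ≤-trans drop (after-excess κ v) }
      where
      open +-*-Solver
      open Budget rest

    budget-drop : ∀ κ v → excess d (afterIndividualizing κ v) + d ≤ excess d κ → Budget (afterIndividualizing κ v) → Budget κ
    budget-drop κ v drops rest = record
      { a = a ; b = suc b ; s = s ; isolated = isolated
      ; depth = depth-mono (≤-reflexive (cong (_+ (s + residue d)) (sym (+-suc a b)))) (depth-after κ v depth)
      ; growth = ≤-trans (+-monoʳ-≤ (4 * a) (after-numClasses κ v)) growth
      ; drop = ≤-trans (≤-reflexive (trans (*-suc d b) (+-comm d (d * b)))) (≤-trans (+-monoˡ-≤ d drop) drops) }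
      where open Budget rest

    budget-terminal : ∀ κ → ∃[ s ] d * s ≤ n G × Depth≤ (colored κ) (s + residue d) → Budget κ
    budget-terminal κ (s , isolated , depth) = record
      { a = 0 ; b = 0 ; s = s ; growth = count≤size (λ c → some (λ x → κ x ≐ c))
      ; drop = ≤-trans (≤-reflexive (*-zeroʳ d)) z≤n ; isolated = isolated ; depth = depth }

    measure : Coloring → ℕ
    measure κ = (n G ∸ numClasses κ) + excess d κ

    measure-growth : ∀ κ v → numClasses κ + 4 ≤ numClasses (afterIndividualizing κ v) → measure (afterIndividualizing κ v) < measure κ
    measure-growth κ v grows = +-mono-<-≤
      (∸-monoʳ-< (≤-trans (m<m+n (numClasses κ) (s≤s z≤n)) grows) (count≤size (λ c → some (λ x → afterIndividualizing κ v x ≐ c))))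
      (after-excess κ v)

    measure-drop : ∀ κ v → excess d (afterIndividualizing κ v) + d ≤ excess d κ → measure (afterIndividualizing κ v) < measure κ
    measure-drop κ v drops = +-mono-≤-< (∸-monoʳ-≤ (n G) (after-numClasses κ v))
      (<-≤-trans (m<m+n (excess d (afterIndividualizing κ v)) 1≤d) drops)

    budget : ∀ κ → Equitable (adj G) κ → Acc _<_ (measure κ) → Budget κ
    budget κ equitable (acc rec)
      with any? (λ v → numClasses κ + 4 ≤? numClasses (afterIndividualizing κ v))
         | any? (λ v → excess d (afterIndividualizing κ v) + d ≤? excess d κ)
    ... | yes (v , grows) | _               = budget-growth κ v grows
            (budget (afterIndividualizing κ v) (after-equitable κ v) (rec (measure-growth κ v grows)))
    ... | no _            | yes (v , drops) = budget-drop κ v drops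
            (budget (afterIndividualizing κ v) (after-equitable κ v) (rec (measure-drop κ v drops)))
    ... | no no-growth    | no no-drop      = budget-terminal κ
            (terminal κ equitable (λ v h → no-growth (v , h)) (λ v h → no-drop (v , h)))

  -- Divided by `4 * d`, the bound reads `k ≤ n/4 + 3n/d`. The 12 is 4 times 3, since the balanced
  -- splits, the isolated vertices and the residue are each at most `n/d`.
  depth-bound : ∀ G d → 1 ≤ d → d * residue d ≤ n G → ∃[ k ] Depth≤ G k × 4 * (d * k) ≤ d * n G + 12 * n G
  depth-bound G d 1≤d residue≤ = k , depth-refine depth , bound
    where
    open Refining G d 1≤d
    open Refinement (refine G)
    open Budget (budget κ equitable (<-wellFounded _))
    k = a + b + (s + residue d)
    bound : 4 * (d * k) ≤ d * n G + 12 * n G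
    bound = begin
      4 * (d * k)                                                   ≡⟨ solve 5 (λ d a b s r → con 4 :* (d :* (a :+ b :+ (s :+ r))) :=
                                                                        d :* (con 4 :* a) :+ con 4 :* (d :* b :+ (d :* s :+ d :* r))) refl d a b s (residue d) ⟩
      d * (4 * a) + 4 * (d * b + (d * s + d * residue d))           ≤⟨ +-mono-≤ (*-monoʳ-≤ d (≤-trans (m≤m+n (4 * a) _) growth))
                                                                        (*-monoʳ-≤ 4 (+-mono-≤ (≤-trans drop (excess≤size d κ)) (+-mono-≤ isolated residue≤))) ⟩
      d * n G + 4 * (n G + (n G + n G))                             ≡⟨ cong (d * n G +_) (solve 1 (λ x → con 4 :* (x :+ (x :+ x)) := con 12 :* x) refl (n G)) ⟩
      d * n G + 12 * n G                                            ∎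
      where
      open ≤-Reasoning
      open +-*-Solver

-- The error term

open import Data.Integer using (+_; -[1+_])
import Data.Integer as ℤ
import Data.Integer.Properties as ℤ
open import Data.Nat.Coprimality using (Coprime)
open import Data.Rational using (ℚ; mkℚ; *<*; _/_; _+_; _*_) renaming (_≤_ to _≤ℚ_)
import Data.Rational.Properties as ℚ
open import Data.Rational.Unnormalised using (mkℚᵘ; *≤*)
import Data.Rational.Unnormalised.Properties as ℚᵘ

-- A downward search for the largest affordable argument. The value 0 doubles as failure:
-- `cost zero` is never tested, whence the two cases of `largest-spec`.
largest : (ℕ → ℕ) → ℕ → ℕ → ℕ
largest cost b zero    = 0
largest cost b (suc k) with cost (suc k) ℕ.≤? b
... | yes _ = suc k
... | no _  = largest cost b k

largest-spec : ∀ cost b k → largest cost b k ≡ 0 ⊎ cost (largest cost b k) ℕ.≤ b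
largest-spec cost b zero    = inj₁ refl
largest-spec cost b (suc k) with cost (suc k) ℕ.≤? b
... | yes h = inj₂ h
... | no _  = largest-spec cost b k

largest-max : ∀ cost b k {e} → e ℕ.≤ k → cost e ℕ.≤ b → e ℕ.≤ largest cost b k
largest-max cost b zero    e≤k h = e≤k
largest-max cost b (suc k) e≤k h with cost (suc k) ℕ.≤? b
... | yes _ = e≤k
... | no ¬h with ℕ.m≤n⇒m<n∨m≡n e≤k
...   | inj₁ (s≤s e≤k') = largest-max cost b k e≤k' h
...   | inj₂ refl       = contradiction h ¬h

quarter-bound : ∀ k b e → 4 ℕ.* (suc e ℕ.* k) ℕ.≤ suc e ℕ.* b ℕ.+ 12 ℕ.* b →
  ℕ→ℚ k ≤ℚ (+ b) / 4 + (+ (3 ℕ.* b)) / suc e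
quarter-bound k b e h = ℚ.toℚᵘ-cancel-≤
  (ℚᵘ.≤-respˡ-≃ (ℚᵘ.≃-sym (ℚ.toℚᵘ-fromℚᵘ (mkℚᵘ (+ k) 0)))
  (ℚᵘ.≤-respʳ-≃ (ℚᵘ.≃-sym (ℚᵘ.≃-trans (ℚ.toℚᵘ-homo-+ ((+ b) / 4) ((+ (3 ℕ.* b)) / suc e))
    (ℚᵘ.+-cong (ℚ.toℚᵘ-fromℚᵘ (mkℚᵘ (+ b) 3)) (ℚ.toℚᵘ-fromℚᵘ (mkℚᵘ (+ (3 ℕ.* b)) e)))))
  (*≤* (subst₂ ℤ._≤_ left right (ℤ.+≤+ h')))))
  where
  open +-*-Solver
  h' : k ℕ.* (4 ℕ.* suc e) ℕ.≤ (b ℕ.* suc e ℕ.+ 3 ℕ.* b ℕ.* 4) ℕ.* 1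
  h' = subst₂ ℕ._≤_
    (solve 2 (λ k d → con 4 :* (d :* k) := k :* (con 4 :* d)) refl k (suc e))
    (solve 2 (λ b d → d :* b :+ con 12 :* b := (b :* d :+ con 3 :* b :* con 4) :* con 1) refl b (suc e)) h
  left : + (k ℕ.* (4 ℕ.* suc e)) ≡ + k ℤ.* (+ (4 ℕ.* suc e))
  left = ℤ.pos-* k _
  right : + ((b ℕ.* suc e ℕ.+ 3 ℕ.* b ℕ.* 4) ℕ.* 1) ≡ (+ b ℤ.* + suc e ℤ.+ + (3 ℕ.* b) ℤ.* + 4) ℤ.* + 1
  right = trans (ℤ.pos-* (b ℕ.* suc e ℕ.+ 3 ℕ.* b ℕ.* 4) 1) (cong (ℤ._* + 1) (trans (ℤ.pos-+ (b ℕ.* suc e) _) (cong₂ ℤ._+_ (ℤ.pos-* b _) (ℤ.pos-* (3 ℕ.* b) 4))))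

-- With `ε = (p+1)/(q+1)`, the left side is at most `b/(q+1)`, and `p+1 ≥ 1` does the rest.
fraction-small : ∀ p q .(c : Coprime (suc p) (suc q)) b e → 3 ℕ.* suc q ℕ.≤ suc e → (+ (3 ℕ.* b)) / suc e ≤ℚ mkℚ (+ suc p) q c * ℕ→ℚ b
fraction-small p q c b e h = ℚ.toℚᵘ-cancel-≤
  (ℚᵘ.≤-respˡ-≃ (ℚᵘ.≃-sym (ℚ.toℚᵘ-fromℚᵘ (mkℚᵘ (+ (3 ℕ.* b)) e)))
  (ℚᵘ.≤-respʳ-≃ (ℚᵘ.≃-sym (ℚᵘ.≃-trans (ℚ.toℚᵘ-homo-* (mkℚ (+ suc p) q c) (ℕ→ℚ b))
    (ℚᵘ.*-cong (ℚᵘ.≃-refl {mkℚᵘ (+ suc p) q}) (ℚ.toℚᵘ-fromℚᵘ (mkℚᵘ (+ b) 0)))))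
  (*≤* (subst₂ ℤ._≤_ (ℤ.pos-* (3 ℕ.* b) _) (trans (ℤ.pos-* (suc p ℕ.* b) (suc e)) (cong (ℤ._* + suc e) (ℤ.pos-* (suc p) b))) (ℤ.+≤+ h')))))
  where
  open ℕ.≤-Reasoning
  open +-*-Solver using (solve; _:*_; _:=_; con)
  h' : 3 ℕ.* b ℕ.* (suc q ℕ.* 1) ℕ.≤ suc p ℕ.* b ℕ.* suc e
  h' = begin
    3 ℕ.* b ℕ.* (suc q ℕ.* 1)  ≡⟨ solve 2 (λ b q → con 3 :* b :* (q :* con 1) := b :* (con 3 :* q)) refl b (suc q) ⟩
    b ℕ.* (3 ℕ.* suc q)        ≤⟨ ℕ.*-monoʳ-≤ b h ⟩
    b ℕ.* suc e                ≤⟨ ℕ.*-monoˡ-≤ (suc e) (ℕ.m≤m+n b (p ℕ.* b)) ⟩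
    suc p ℕ.* b ℕ.* suc e      ∎

module ErrorTerm (cost : ℕ → ℕ) where

  threshold : ℕ → ℕ
  threshold b = largest cost b b

  errorTerm : ℕ → ℚ
  errorTerm b = (+ (3 ℕ.* b)) / suc (threshold b)

  errorTerm-littleO : IsLittleO-n errorTerm
  errorTerm-littleO (mkℚ (+ zero)  q c) (*<* (ℤ.+<+ ()))
  errorTerm-littleO (mkℚ -[1+ p ] q c) (*<* ())
  -- From this bound on, `e` is at most `b` and affordable, so the threshold is at least
  -- `e = 3 * suc q`; the 3 absorbs the numerator of the error term.
  errorTerm-littleO (mkℚ (+ suc p) q c) _ = e ℕ.⊔ cost e , λ b N≤b →
    subst (_≤ℚ mkℚ (+ suc p) q c * ℕ→ℚ b)
      (sym (ℚ.0≤p⇒∣p∣≡p (ℚ.nonNegative⁻¹ (errorTerm b) {{ℚ.normalize-nonNeg (3 ℕ.* b) (suc (threshold b))}})))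
      (fraction-small p q c b (threshold b) (ℕ.m≤n⇒m≤1+n
        (largest-max cost b b (ℕ.≤-trans (ℕ.m≤m⊔n e (cost e)) N≤b) (ℕ.≤-trans (ℕ.m≤n⊔m e (cost e)) N≤b))))
    where
    e : ℕ
    e = 3 ℕ.* suc q

  errorTerm-bounds : (∀ G e → cost e ℕ.≤ n G → ∃[ k ] Depth≤ G k × 4 ℕ.* (suc e ℕ.* k) ℕ.≤ suc e ℕ.* n G ℕ.+ 12 ℕ.* n G) →
    ∀ G → WLD2≤ G ((+ n G) / 4 + errorTerm (n G))
  errorTerm-bounds bound G with largest-spec cost (n G) (n G)
  ... | inj₂ affordable with bound G (threshold (n G)) affordable
  ...   | k , (t , t≤k) , h = t , quarter-bound (indDepth t) (n G) (threshold (n G))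
          (ℕ.≤-trans (ℕ.*-monoʳ-≤ 4 (ℕ.*-monoʳ-≤ (suc (threshold (n G))) t≤k)) h)
  -- At threshold 0 the error term is `3n`, so the trivial depth `n` is good enough.
  errorTerm-bounds bound G | inj₁ zero-threshold with depth≤order G
  ... | t , t≤n = t , quarter-bound (indDepth t) (n G) (threshold (n G)) trivial
    where
    trivial : 4 ℕ.* (suc (threshold (n G)) ℕ.* indDepth t) ℕ.≤ suc (threshold (n G)) ℕ.* n G ℕ.+ 12 ℕ.* n G
    trivial rewrite zero-threshold = ℕ.≤-trans (ℕ.*-monoʳ-≤ 4 (ℕ.≤-trans (ℕ.≤-reflexive (ℕ.*-identityˡ _)) t≤n))
      (ℕ.≤-trans (ℕ.*-monoˡ-≤ (n G) {4} {12} (s≤s (s≤s (s≤s (s≤s z≤n))))) (ℕ.m≤n+m (12 ℕ.* n G) (1 ℕ.* n G)))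

-- The parameter is `d = suc e`, which keeps it positive, and the cost is the size of `n` that
-- `depth-bound` demands for this `d`.
open ErrorTerm (λ e → suc e ℕ.* residue (suc e))

theorem23 : Σ (ℕ → ℚ) λ g → IsLittleO-n g ×
    ((G : ColGraph) → WLD2≤ G (((+ n G) / 4) + g (n G)))
theorem23 = errorTerm , errorTerm-littleO , errorTerm-bounds (λ G e → depth-bound G (suc e) (s≤s z≤n))
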